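{- Assume the constraint theory $CT$ allows the built-in predicate $=$ and the signature contains at least a constant symbol and a function symbol of arity $>0$. Let $\mathcal{G}$ be a class of goals such that if $H$ is a head of a rule then $K\in\mathcal{G}$ for any $K\subseteq H$ (multiset inclusion). Then, for $n\ge 2$, there exists no acceptable encoding, and no acceptable encoding for qualified answers, of $\mathrm{CHR}_n$ in $\mathrm{CHR}_1$ for the class $\mathcal{G}$.
   Context: **CHR.** Fix a signature whose predicate symbols are split into two disjoint sets $\Pi_b$ (built-in) and $\Pi_u$ (user-defined), and a first-order theory $CT$ giving the meaning of built-ins. Built-in constraints are given by $c::=a\mid c\wedge c\mid\exists_x c$ with $a$ an atomic formula over $\Pi_b$; a user-defined constraint is an atomic formula over $\Pi_u$. Conjunctions of atomic constraints are treated as multisets; "," denotes conjunction (multiset union); ${\tt true}$ is the empty multiset of built-in constraints. $Fv(\phi)$ is the set of free variables of $\phi$, and $\exists_{ -V}\phi$ is the existential closure of $\phi$ except for the variables in $V$. $p(\bar t)=p(\bar t')$ denotes the componentwise equalities $\bar t=\bar t'$ (undefined for different predicate symbols), extended in the expected way to multisets of constraints. A simplification rule has the form $H\Leftrightarrow C\mid B$ and a propagation rule the form $H\Rightarrow C\mid B$, where the head $H$ is a nonempty multiset of user-defined constraints, the guard $C$ a multiset of built-in constraints, and the body $B$ a multiset of constraints of both kinds. A program is a finite set of rules; a goal is a multiset of constraints of both kinds. Configurations are triples $\langle G,K,d\rangle$ ($G$ the constraints still to be solved, $K$ the accumulated user-defined constraints, $d$ a built-in constraint). For a program $P$, the relation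 $\longrightarrow$ is the least one such that: - Solve: $\langle (c,G),K,d\rangle\longrightarrow\langle G,K,d'\rangle$ if $c$ is built-in and $CT\models c\wedge d\leftrightarrow d'$; - Introduce: $\langle (h,G),K,d\rangle\longrightarrow\langle G,(h,K),d\rangle$ if $h$ is user-defined; - Simplify: $\langle G,H'\wedge K,d\rangle\longrightarrow\langle B\wedge G,K,H=H'\wedge d\rangle$ if $(H\Leftrightarrow C\mid B)\in P$, $x=Fv(H)$ and $CT\models d\rightarrow\exists_x((H=H')\wedge C)$; - Propagate: $\langle G,H'\wedge K,d\rangle\longrightarrow\langle B\wedge G,H'\wedge K,H=H'\wedge d\rangle$ if $(H\Rightarrow C\mid B)\in P$, $x=Fv(H)$ and $CT\models d\rightarrow\exists_x((H=H')\wedge C)$. In Simplify and Propagate the program rule is renamed with fresh variables. The data sufficient and qualified answers of $G$ in $P$ are $$\mathcal{SA}_P(G)=\{\exists_{ -Fv(G)}d\mid\langle G,\emptyset,\emptyset\rangle\longrightarrow^*\langle\emptyset,\emptyset,d\rangle\not\longrightarrow\},\quad \mathcal{QA}_P(G)=\{\exists_{ -Fv(G)}(K\wedge d)\mid \langle G,\emptyset,\emptyset\rangle\longrightarrow^*\langle\emptyset,K,d\rangle\not\longrightarrow\}.$$ Answers are read up to logical equivalence under $CT$ with respect to built-in constraints; multiplicity of user-defined constraints matters. **Dialects.** $\mathrm{CHR}_n$ is the CHR language where the number of atoms in the head of each rule is at most $n$. **Acceptable encodings.** For a CHR (sub)language $\mathrm{CHR}_x$ let $\mathcal{P}_x$ be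 the set of its programs and $\mathcal{G}_x$ the set of its possible goals (the user-defined predicates of source and target languages may differ). An acceptable encoding of $\mathrm{CHR}_x$ into $\mathrm{CHR}_y$ for the class of goals $\mathcal{G}$ is a pair of mappings $[\![\ ]\!]:\mathcal{P}_x\to\mathcal{P}_y$ and $[\![\ ]\!]_g:\mathcal{G}_x\to\mathcal{G}_y$ such that: (1) $\mathcal{P}_x$ and $\mathcal{P}_y$ share the same $CT$; (2) for any goal $(A,B)\in\mathcal{G}_x$, $[\![A,B]\!]_g=[\![A]\!]_g,[\![B]\!]_g$, and the built-ins present in the goal are left unchanged; (3) for all $P\in\mathcal{P}_x$ and $G\in\mathcal{G}$, $\mathcal{SA}_P(G)=\mathcal{SA}_{[\![P]\!]}([\![G]\!]_g)$. An acceptable encoding for qualified answers is defined in the same way, with (3) replaced by: (3') for all $P\in\mathcal{P}_x$ and $G\in\mathcal{G}$, $\mathcal{QA}_P(G)=\mathcal{QA}_{[\![P]\!]}([\![G]\!]_g)$. -}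

module Defs where

open import Level using (Level; 0ℓ; _⊔_) renaming (suc to lsuc)
open import Data.Empty using (⊥)
open import Data.Unit using (⊤)
open import Data.Nat using (ℕ; _≤_; _≟_)
open import Data.List using (List; []; _∷_; _++_; map; concatMap; foldr; filter; length)
open import Data.List.Membership.Propositional using (_∈_; _∉_)
open import Data.List.Membership.DecPropositional _≟_ using (_∈?_)
open import Data.List.Relation.Unary.All using (All)
open import Data.List.Relation.Binary.Permutation.Propositional using (_↭_)
open import Data.List.Relation.Binary.Permutation.Homogeneous using (Permutation)
open import Data.Product using (Σ; ∃; ∃-syntax; _×_; _,_; proj₁)
open import Data.Sum using (_⊎_)
open import Data.Vec using (Vec; []; _∷_)
open import Data.Vec.Relation.Binary.Pointwise.Inductive using (Pointwise)
open import Function.Definitions using (Injective)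
open import Relation.Binary using (Rel; IsEquivalence)
open import Relation.Binary.Construct.Closure.ReflexiveTransitive using (Star)
open import Relation.Binary.PropositionalEquality using (_≡_; _≢_)
open import Relation.Nullary using (¬_; Dec; yes; no; ¬?)
open import Relation.Unary using (Pred)

-- `Rel` lists the built-in predicate symbols other than `=`, which has its own
-- syntax below.  `User` is a common universe of user-defined predicate symbols:
-- each CHR language uses a subset of it, so that the source and the target of
-- an encoding may use different symbols while qualified answers, which mention
-- these symbols, can still be compared.
record Signature : Set₁ where
  field
    Fun          : Set
    fun-arity    : Fun → ℕ
    BuiltinRel   : Set
    rel-arity    : BuiltinRel → ℕ
    User         : Set
    user-arity   : User → ℕ

open Signature public

Var : Set
Var = ℕ

module _ (S : Signature) where

  data Term : Set where
    var : Var → Term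
    app : (f : Fun S) → Vec Term (fun-arity S f) → Term

  data BuiltinAtom : Set where
    rel : (r : BuiltinRel S) → Vec Term (rel-arity S r) → BuiltinAtom
    _≐_ : Term → Term → BuiltinAtom

  data Builtin : Set where
    atom : BuiltinAtom → Builtin
    _∧_  : Builtin → Builtin → Builtin
    ex   : Var → Builtin → Builtin

  data Formula : Set where
    atom        : BuiltinAtom → Formula
    true false  : Formula
    _∧_ _∨_ _⇒_ : Formula → Formula → Formula
    all ex      : Var → Formula → Formula

  Language : Set₁
  Language = Pred (User S) 0ℓ

  -- The membership proof is irrelevant, so that equality of atoms does not
  -- depend on it.
  record UserAtom (Π : Language) : Set where
    constructor user-atom
    field
      sym   : User S
      .sym∈ : Π sym
      args  : Vec Term (user-arity S sym)

  data Constraint (Π : Language) : Set where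
    builtin : Builtin → Constraint Π
    user    : UserAtom Π → Constraint Π

  -- Multisets are lists, always used up to _↭_.
  Builtins : Set
  Builtins = List Builtin

  Goal : Language → Set
  Goal Π = List (Constraint Π)

module _ {S : Signature} where

  ⌊_⌋ : Builtin S → Formula S
  ⌊ atom a ⌋ = atom a
  ⌊ c ∧ d ⌋  = ⌊ c ⌋ ∧ ⌊ d ⌋
  ⌊ ex x c ⌋ = ex x ⌊ c ⌋

  ⋀ : Builtins S → Formula S
  ⋀ []       = true
  ⋀ (c ∷ cs) = ⌊ c ⌋ ∧ ⋀ cs

  _⇔_ : Formula S → Formula S → Formula S
  φ ⇔ ψ = (φ ⇒ ψ) ∧ (ψ ⇒ φ)

  ∃ᶠ[_]_ : List Var → Formula S → Formula S
  ∃ᶠ[ xs ] φ = foldr ex φ xs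

  mutual
    fvᵗ : Term S → List Var
    fvᵗ (var x)    = x ∷ []
    fvᵗ (app f ts) = fvᵗˢ ts

    fvᵗˢ : ∀ {n} → Vec (Term S) n → List Var
    fvᵗˢ []       = []
    fvᵗˢ (t ∷ ts) = fvᵗ t ++ fvᵗˢ ts

  fvᵃ : BuiltinAtom S → List Var
  fvᵃ (rel r ts) = fvᵗˢ ts
  fvᵃ (s ≐ t)    = fvᵗ s ++ fvᵗ t

  _without_ : List Var → Var → List Var
  xs without x = filter (λ y → ¬? (y ≟ x)) xs

  fvᶠ : Formula S → List Var
  fvᶠ (atom a)  = fvᵃ a
  fvᶠ true      = []
  fvᶠ false     = []
  fvᶠ (φ ∧ ψ)   = fvᶠ φ ++ fvᶠ ψ
  fvᶠ (φ ∨ ψ)   = fvᶠ φ ++ fvᶠ ψ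
  fvᶠ (φ ⇒ ψ)   = fvᶠ φ ++ fvᶠ ψ
  fvᶠ (all x φ) = fvᶠ φ without x
  fvᶠ (ex x φ)  = fvᶠ φ without x

  fvᵇ : Builtin S → List Var
  fvᵇ c = fvᶠ ⌊ c ⌋

  ∃₋[_]_ : List Var → Formula S → Formula S
  ∃₋[ V ] φ = ∃ᶠ[ filter (λ x → ¬? (x ∈? V)) (fvᶠ φ) ] φ

  module _ {Π : Language S} where

    fvᵘ : UserAtom S Π → List Var
    fvᵘ h = fvᵗˢ (UserAtom.args h)

    fvᶜ : Constraint S Π → List Var
    fvᶜ (builtin c) = fvᵇ c
    fvᶜ (user h)    = fvᵘ h

    fvᵍ : Goal S Π → List Var
    fvᵍ = concatMap fvᶜ

  mutual
    renᵗ : (Var → Var) → Term S → Term S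
    renᵗ ρ (var x)    = var (ρ x)
    renᵗ ρ (app f ts) = app f (renᵗˢ ρ ts)

    renᵗˢ : ∀ {n} → (Var → Var) → Vec (Term S) n → Vec (Term S) n
    renᵗˢ ρ []       = []
    renᵗˢ ρ (t ∷ ts) = renᵗ ρ t ∷ renᵗˢ ρ ts

  -- Only ever used with injective ρ; renaming the bound variables as well then
  -- rules out capture.
  renᵇ : (Var → Var) → Builtin S → Builtin S
  renᵇ ρ (atom (rel r ts)) = atom (rel r (renᵗˢ ρ ts))
  renᵇ ρ (atom (s ≐ t))    = atom (renᵗ ρ s ≐ renᵗ ρ t)
  renᵇ ρ (c ∧ d)           = renᵇ ρ c ∧ renᵇ ρ d
  renᵇ ρ (ex x c)          = ex (ρ x) (renᵇ ρ c)

  renᵘ : ∀ {Π} → (Var → Var) → UserAtom S Π → UserAtom S Π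
  renᵘ ρ (user-atom p p∈ ts) = user-atom p p∈ (renᵗˢ ρ ts)

  renᶜ : ∀ {Π} → (Var → Var) → Constraint S Π → Constraint S Π
  renᶜ ρ (builtin c) = builtin (renᵇ ρ c)
  renᶜ ρ (user h)    = user (renᵘ ρ h)

  equations : ∀ {n} → Vec (Term S) n → Vec (Term S) n → Builtins S
  equations []       []       = []
  equations (s ∷ ss) (t ∷ ts) = atom (s ≐ t) ∷ equations ss ts

  -- `H ≐ H′ ↝ E`: the equations H = H′ are defined, and E lists them.  Atoms are
  -- paired in order; the choice of a pairing of two multisets is left to the
  -- permutation that extracts H′ from the store in the transition rules.
  data _≐_↝_ {Π : Language S} :
    List (UserAtom S Π) → List (UserAtom S Π) → Builtins S → Set where
    []  : [] ≐ [] ↝ []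
    _∷_ : ∀ {p} .{p∈ p∈′ : Π p} ts ts′ {H H′ E} → H ≐ H′ ↝ E →
          (user-atom p p∈ ts ∷ H) ≐ (user-atom p p∈′ ts′ ∷ H′)
            ↝ (equations ts ts′ ++ E)

module _ (S : Signature) where

  record Structure : Set₁ where
    field
      Carrier : Set
      ⟦_⟧ᶠ    : (f : Fun S) → Vec Carrier (fun-arity S f) → Carrier
      ⟦_⟧ʳ    : (r : BuiltinRel S) → Vec Carrier (rel-arity S r) → Set
      _≈_     : Rel Carrier 0ℓ

module _ {S : Signature} (M : Structure S) where
  open Structure M

  Valuation : Set
  Valuation = Var → Carrier

  mutual
    eval : Valuation → Term S → Carrier
    eval σ (var x)    = σ x
    eval σ (app f ts) = ⟦ f ⟧ᶠ (evals σ ts)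

    evals : ∀ {n} → Valuation → Vec (Term S) n → Vec Carrier n
    evals σ []       = []
    evals σ (t ∷ ts) = eval σ t ∷ evals σ ts

  _[_↦_] : Valuation → Var → Carrier → Valuation
  (σ [ x ↦ a ]) y with y ≟ x
  ... | yes _ = a
  ... | no  _ = σ y

  Sat : Valuation → Formula S → Set
  Sat σ (atom (rel r ts)) = ⟦ r ⟧ʳ (evals σ ts)
  Sat σ (atom (s ≐ t))    = eval σ s ≈ eval σ t
  Sat σ true              = ⊤
  Sat σ false             = ⊥
  Sat σ (φ ∧ ψ)           = Sat σ φ × Sat σ ψ
  Sat σ (φ ∨ ψ)           = Sat σ φ ⊎ Sat σ ψ
  Sat σ (φ ⇒ ψ)           = Sat σ φ → Sat σ ψ
  Sat σ (all x φ)         = ∀ a → Sat (σ [ x ↦ a ]) φ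
  Sat σ (ex x φ)          = ∃[ a ] Sat (σ [ x ↦ a ]) φ

  GroundAtom : Set
  GroundAtom = Σ (User S) λ p → Vec Carrier (user-arity S p)

  data _≈ᵍ_ : GroundAtom → GroundAtom → Set where
    ground : ∀ {p as bs} → Pointwise _≈_ as bs → (p , as) ≈ᵍ (p , bs)

  instantiate : ∀ {Π} → Valuation → UserAtom S Π → GroundAtom
  instantiate σ (user-atom p _ ts) = p , evals σ ts

-- Free variables in axioms are read as universally quantified.
Theory : Signature → Set₁
Theory S = Pred (Formula S) 0ℓ

module _ {S : Signature} (CT : Theory S) where

  -- `two-valued` makes first-order logic classical without assuming excluded
  -- middle in the metatheory (where it would hold of every structure).
  record Model (M : Structure S) : Set where
    field
      two-valued : ∀ σ φ → Dec (Sat M σ φ)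
      axioms     : ∀ φ → CT φ → ∀ σ → Sat M σ φ

  _⊨_ : Formula S → Set₁
  _⊨_ φ = ∀ M → Model M → ∀ σ → Sat M σ φ

record IsEquality {S : Signature} (M : Structure S) : Set where
  open Structure M
  field
    isEquivalence : IsEquivalence _≈_
    fun-cong      : ∀ f {as bs} → Pointwise _≈_ as bs → ⟦ f ⟧ᶠ as ≈ ⟦ f ⟧ᶠ bs
    rel-resp      : ∀ r {as bs} → Pointwise _≈_ as bs → ⟦ r ⟧ʳ as → ⟦ r ⟧ʳ bs

-- CT entails the axioms of equality for `=`.
AllowsEquality : {S : Signature} → Theory S → Set₁
AllowsEquality CT = ∀ M → Model CT M → IsEquality M

data RuleKind : Set where
  simplification propagation : RuleKind

module _ (S : Signature) (Π : Language S) where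

  record Rule : Set where
    field
      kind     : RuleKind
      head     : List (UserAtom S Π)
      nonempty : head ≢ []
      guard    : Builtins S
      body     : Goal S Π

  HeadSize≤ : ℕ → Rule → Set
  HeadSize≤ n r = length (Rule.head r) ≤ n

  -- Programs of CHRₙ over the user-defined predicates Π.
  Program : ℕ → Set
  Program n = Σ (List Rule) (All (HeadSize≤ n))

  record Config : Set where
    constructor ⟨_,_,_⟩
    field
      goal  : Goal S Π
      store : List (UserAtom S Π)
      built : Builtins S

  record Answer : Set where
    constructor ∃₋⟨_⟩_,_
    field
      visible : List Var
      store   : List (UserAtom S Π)
      built   : Builtins S

module _ {S : Signature} {Π : Language S} where

  fvᵣ : Rule S Π → List Var
  fvᵣ r = concatMap fvᵘ head ++ concatMap fvᵇ guard ++ fvᵍ body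
    where open Rule r

  fvₛ : Config S Π → List Var
  fvₛ ⟨ G , K , d ⟩ = fvᵍ G ++ concatMap fvᵘ K ++ concatMap fvᵇ d

  record FreshRenaming (W : List Var) (r : Rule S Π) : Set where
    field
      ρ         : Var → Var
      injective : Injective _≡_ _≡_ ρ
      fresh     : ∀ {x} → x ∈ fvᵣ r → ρ x ∉ W

    head : List (UserAtom S Π)
    head = map (renᵘ ρ) (Rule.head r)

    guard : Builtins S
    guard = map (renᵇ ρ) (Rule.guard r)

    body : Goal S Π
    body = map (renᶜ ρ) (Rule.body r)

module _ {S : Signature} (CT : Theory S) {Π : Language S} where

  Applicable : Builtins S → List (UserAtom S Π) → Builtins S → Builtins S → Set₁
  Applicable d H E C = CT ⊨ (⋀ d ⇒ (∃ᶠ[ concatMap fvᵘ H ] (⋀ E ∧ ⋀ C)))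

  -- W contains the variables that a renamed rule has to avoid.
  data Step (P : List (Rule S Π)) (W : List Var) :
    Config S Π → Config S Π → Set₁ where

    solve : ∀ {G G′ K c d d′} →
      G ↭ builtin c ∷ G′ →
      CT ⊨ ((⌊ c ⌋ ∧ ⋀ d) ⇔ ⋀ d′) →
      Step P W ⟨ G , K , d ⟩ ⟨ G′ , K , d′ ⟩

    introduce : ∀ {G G′ K h d} →
      G ↭ user h ∷ G′ →
      Step P W ⟨ G , K , d ⟩ ⟨ G′ , h ∷ K , d ⟩

    simplify : ∀ {G K H′ K′ d E r} →
      r ∈ P → Rule.kind r ≡ simplification →
      (v : FreshRenaming W r) (let open FreshRenaming v) →
      K ↭ H′ ++ K′ →
      head ≐ H′ ↝ E →
      Applicable d head E guard →
      Step P W ⟨ G , K , d ⟩ ⟨ body ++ G , K′ , E ++ d ⟩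

    propagate : ∀ {G K H′ K′ d E r} →
      r ∈ P → Rule.kind r ≡ propagation →
      (v : FreshRenaming W r) (let open FreshRenaming v) →
      K ↭ H′ ++ K′ →
      head ≐ H′ ↝ E →
      Applicable d head E guard →
      Step P W ⟨ G , K , d ⟩ ⟨ body ++ G , K , E ++ d ⟩

  -- A configuration together with the variables that occurred so far in the
  -- derivation: fresh variables are new to the whole derivation, since the
  -- variables of the initial goal stay meaningful in the answer even when they
  -- no longer occur in the configuration.
  State : Set
  State = List Var × Config S Π

  Transition : List (Rule S Π) → State → State → Set₁
  Transition P (W , s) (W′ , s′) = Step P W s s′ × W′ ≡ fvₛ s′ ++ W

  Final : List (Rule S Π) → State → Set₁
  Final P s = ∀ s′ → ¬ Transition P s s′

  initial : Goal S Π → State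
  initial G = fvᵍ G , ⟨ G , [] , [] ⟩

  _⊢_⇓_,_ : List (Rule S Π) → Goal S Π → List (UserAtom S Π) → Builtins S → Set₁
  P ⊢ G ⇓ K , d = ∃[ W ]
    Star (Transition P) (initial G) (W , ⟨ [] , K , d ⟩) × Final P (W , ⟨ [] , K , d ⟩)

  SA : List (Rule S Π) → Goal S Π → Pred (Formula S) (lsuc 0ℓ)
  SA P G φ = ∃[ d ] (P ⊢ G ⇓ [] , d) × φ ≡ ∃₋[ fvᵍ G ] (⋀ d)

  QA : List (Rule S Π) → Goal S Π → Pred (Answer S Π) (lsuc 0ℓ)
  QA P G a = ∃[ K ] ∃[ d ] (P ⊢ G ⇓ K , d) × a ≡ (∃₋⟨ fvᵍ G ⟩ K , d)

  -- `Denotes M σ a m`: under σ, which fixes the visible variables, the answer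
  -- a = ∃₋V (K ∧ d) admits the multiset m of ground instances of K, for some
  -- choice of the local variables satisfying d.
  Denotes : (M : Structure S) → Valuation M → Answer S Π → List (GroundAtom M) → Set
  Denotes M σ (∃₋⟨ V ⟩ K , d) m = ∃[ τ ]
    (∀ {x} → x ∈ V → τ x ≡ σ x) ×
    Sat M τ (⋀ d) ×
    Permutation (_≈ᵍ_ M) (map (instantiate M τ) K) m

module _ {S : Signature} (CT : Theory S) where

  _≈ˢ_ : Formula S → Formula S → Set₁
  φ ≈ˢ ψ = CT ⊨ (φ ⇔ ψ)

  -- Logical equivalence under CT for the built-in part, with user-defined
  -- constraints counted with multiplicity.  For empty stores this says that
  -- ∃₋V d and ∃₋V′ d′ are equivalent under CT.
  _≈ᑫ_ : ∀ {Π Π′} → Answer S Π → Answer S Π′ → Set₁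
  a ≈ᑫ b = ∀ M → Model CT M → ∀ σ m →
    (Denotes CT M σ a m → Denotes CT M σ b m) ×
    (Denotes CT M σ b m → Denotes CT M σ a m)

-- Equality of two sets whose elements are read up to R.
SameSet : ∀ {A B : Set} → (A → B → Set₁) → Pred A (lsuc 0ℓ) → Pred B (lsuc 0ℓ) → Set₁
SameSet R X Y =
  (∀ a → X a → ∃[ b ] Y b × R a b) ×
  (∀ b → Y b → ∃[ a ] X a × R a b)

-- A pair of mappings satisfying the compositionality condition.  Invariance of
-- ⟦_⟧ᵍ under _↭_ follows from `⟦⟧ᵍ-++`.  ⟦_⟧ is not asked to identify lists of
-- rules that present the same program.  The theory CT is shared by the two
-- languages throughout.
record Translation (S : Signature) (Πₛ Πₜ : Language S) (n m : ℕ) : Set where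
  field
    ⟦_⟧        : Program S Πₛ n → Program S Πₜ m
    ⟦_⟧ᵍ       : Goal S Πₛ → Goal S Πₜ
    ⟦⟧ᵍ-++      : ∀ A B → ⟦ A ++ B ⟧ᵍ ↭ ⟦ A ⟧ᵍ ++ ⟦ B ⟧ᵍ
    ⟦⟧ᵍ-builtin : ∀ c → ⟦ builtin c ∷ [] ⟧ᵍ ↭ builtin c ∷ []

module _ {S : Signature} (CT : Theory S) (Πₛ Πₜ : Language S) (n m : ℕ)
         {ℓ : Level} (𝒢 : Pred (Goal S Πₛ) ℓ) where

  -- Of CHRₙ over Πₛ into CHRₘ over Πₜ, for the class of goals 𝒢.
  record AcceptableEncoding : Set (lsuc 0ℓ ⊔ ℓ) where
    field
      translation : Translation S Πₛ Πₜ n m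
    open Translation translation public
    field
      SA-preserved : ∀ P G → 𝒢 G →
        SameSet (_≈ˢ_ CT) (SA CT (proj₁ P) G) (SA CT (proj₁ ⟦ P ⟧) ⟦ G ⟧ᵍ)

  record AcceptableEncodingQA : Set (lsuc 0ℓ ⊔ ℓ) where
    field
      translation : Translation S Πₛ Πₜ n m
    open Translation translation public
    field
      QA-preserved : ∀ P G → 𝒢 G →
        SameSet (_≈ᑫ_ CT) (QA CT (proj₁ P) G) (QA CT (proj₁ ⟦ P ⟧) ⟦ G ⟧ᵍ)

-- 𝒢 contains every K ⊆ H for H the head of a CHRₙ rule.
ContainsSubheads : ∀ {S : Signature} {Π : Language S} {ℓ} →
                   ℕ → Pred (Goal S Π) ℓ → Set ℓ
ContainsSubheads {S} {Π} n 𝒢 =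
  ∀ (r : Rule S Π) → HeadSize≤ S Π n r →
  ∀ K K′ → Rule.head r ↭ K ++ K′ → 𝒢 (map user K)

{-# OPTIONS --safe #-}
module Submission where

open import Defs
open import Level using (Level)
open import Data.Empty using (⊥; ⊥-elim)
open import Data.Unit using (tt)
open import Data.Nat using (ℕ; suc; _+_; _∸_; _≤_; _≥_; _>_; _≟_; z≤n; s≤s)
open import Data.Nat.Properties using (≤-trans; <⇒≱; m≤n+m; m+n∸n≡m)
open import Data.List using (List; []; _∷_; _++_; map; concatMap; filter; length)
open import Data.List.Properties using (length-map; concatMap-++; map-++; ++-conicalˡ)
open import Data.List.Extrema.Nat using (max; xs≤max)
open import Data.List.Membership.Propositional using (_∈_; _∉_)
open import Data.List.Membership.Propositional.Properties
  using (∈-++⁺ˡ; ∈-++⁺ʳ; ∈-++⁻; ∈-map⁺; ∈-map⁻; ∈-filter⁺; ∈-filter⁻; ∈-∃++)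
open import Data.List.Membership.DecPropositional _≟_ using (_∈?_)
open import Data.List.Relation.Unary.Any using (here; there)
open import Data.List.Relation.Unary.All as All using (All; []; _∷_)
open import Data.List.Relation.Binary.Subset.Propositional using (_⊆_)
open import Data.List.Relation.Binary.Subset.Propositional.Properties
  using (⊆-reflexive-↭; concatMap⁺)
open import Data.List.Relation.Binary.Permutation.Propositional
  using (_↭_; ↭-refl; ↭-sym; ↭-trans; prep)
open import Data.List.Relation.Binary.Permutation.Propositional.Properties
  using (∈-resp-↭; ↭-empty-inv; ↭-singleton-inv; ¬x∷xs↭[]; ↭-length; drop-∷; shift;
         ++⁺ˡ; ++⁺ʳ; ++-comm; ++-assoc)
open import Data.List.Relation.Binary.Permutation.Homogeneous as Homogeneous using ()
open import Data.List.Relation.Binary.Pointwise using ([])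
open import Data.Product using (∃; ∃-syntax; _×_; _,_; proj₁; proj₂; swap; map₂)
open import Data.Sum using (_⊎_; inj₁; inj₂; [_,_]′)
open import Data.Vec using (Vec; []; _∷_; replicate)
open import Function using (_∘_; id)
open import Function.Definitions using (Injective)
open import Relation.Binary using (IsEquivalence)
open import Relation.Binary.Construct.Closure.ReflexiveTransitive using (Star; ε; _◅_)
open import Relation.Binary.PropositionalEquality
  using (_≡_; _≢_; refl; sym; trans; cong; cong₂; subst; subst₂)
open import Relation.Nullary using (¬_; yes; no; ¬?; contradiction)
open import Relation.Unary using (Pred)

-- A program with the rules p ⇒ true and p, p ⇔ true separates the two goals p
-- and p, p: the former has no answer, the latter has the answer true.  No CHR₁
-- program does so under a compositional encoding of goals.  With single heads,
-- every step of a derivation of A, B belongs to A or to B.  If the final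
-- built-in store holds for all values of the visible variables (and suitable
-- values of the others), then so does each earlier store, and the built-ins
-- contributed by B can be satisfied whatever the variables of A are.  Hence
-- they help no guard on the side of A, and the steps of A alone form a
-- derivation from A, which is final because its stores are weaker.

private variable
  a b : Level
  A B : Set a

-- Multisets and concatenated variable lists.

-- The occurrence of `x` falls in one of the two parts. In the second case the parts come out
-- exchanged, to fit `Split-swap`.
split-∷ : ∀ {x : A} {ws xs} ys {zs} → ws ↭ x ∷ xs → ws ↭ ys ++ zs →
          (∃[ ys′ ] ys ↭ x ∷ ys′ × xs ↭ ys′ ++ zs) ⊎
          (∃[ zs′ ] zs ↭ x ∷ zs′ × xs ↭ zs′ ++ ys)
split-∷ {x = x} ys {zs} p q with ∈-++⁻ ys (∈-resp-↭ (↭-trans (↭-sym p) q) (here refl))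
... | inj₁ x∈ys with us , vs , refl ← ∈-∃++ x∈ys =
  inj₁ (us ++ vs , shift x us vs ,
        drop-∷ (↭-trans (↭-sym p) (↭-trans q (++⁺ʳ zs (shift x us vs)))))
... | inj₂ x∈zs with us , vs , refl ← ∈-∃++ x∈zs =
  inj₂ (us ++ vs , shift x us vs ,
        drop-∷ (↭-trans (↭-sym p) (↭-trans q
          (↭-trans (++-comm ys zs) (++⁺ʳ ys (shift x us vs))))))

concatMap-++⁻ : ∀ (f : A → List B) xs {ys y} → y ∈ concatMap f (xs ++ ys) →
                y ∈ concatMap f xs ⊎ y ∈ concatMap f ys
concatMap-++⁻ f xs {ys} y∈ =
  ∈-++⁻ (concatMap f xs) (subst (_ ∈_) (concatMap-++ f xs ys) y∈)

concatMap-++⁺ˡ : ∀ (f : A → List B) xs {ys} → concatMap f xs ⊆ concatMap f (xs ++ ys)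
concatMap-++⁺ˡ f xs {ys} = subst (_ ∈_) (sym (concatMap-++ f xs ys)) ∘ ∈-++⁺ˡ

concatMap-⊆-↭ : ∀ (f : A → List B) {xs ys} → xs ↭ ys → concatMap f xs ⊆ concatMap f ys
concatMap-⊆-↭ f p = concatMap⁺ f (⊆-reflexive-↭ p)

concatMap-map-⊆ : ∀ {C : Set} {h : A → C} {k : C → List ℕ} {f : A → List ℕ} {ρ : ℕ → ℕ} →
                  (∀ x → k (h x) ⊆ map ρ (f x)) →
                  ∀ xs → concatMap k (map h xs) ⊆ map ρ (concatMap f xs)
concatMap-map-⊆ {f = f} {ρ} k⊆ (x ∷ xs) {y} y∈ =
  subst (y ∈_) (sym (map-++ ρ (f x) (concatMap f xs)))
    ([ ∈-++⁺ˡ ∘ k⊆ x , ∈-++⁺ʳ _ ∘ concatMap-map-⊆ k⊆ xs ]′ (∈-++⁻ _ y∈))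

-- Free variables under renaming, and freshness.

module _ {S : Signature} where

  mutual
    fvᵗ-ren : ∀ ρ (t : Term S) → fvᵗ (renᵗ ρ t) ≡ map ρ (fvᵗ t)
    fvᵗ-ren ρ (var x)    = refl
    fvᵗ-ren ρ (app f ts) = fvᵗˢ-ren ρ ts

    fvᵗˢ-ren : ∀ {n} ρ (ts : Vec (Term S) n) → fvᵗˢ (renᵗˢ ρ ts) ≡ map ρ (fvᵗˢ ts)
    fvᵗˢ-ren ρ []       = refl
    fvᵗˢ-ren ρ (t ∷ ts) =
      trans (cong₂ _++_ (fvᵗ-ren ρ t) (fvᵗˢ-ren ρ ts)) (sym (map-++ ρ (fvᵗ t) (fvᵗˢ ts)))

  fvᵇ-ren : ∀ {ρ} → Injective _≡_ _≡_ ρ → ∀ c → fvᵇ {S} (renᵇ ρ c) ⊆ map ρ (fvᵇ c)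
  fvᵇ-ren {ρ} inj (atom (rel r ts)) {y} = subst (y ∈_) (fvᵗˢ-ren ρ ts)
  fvᵇ-ren {ρ} inj (atom (s ≐ t))    {y} = subst (y ∈_)
    (trans (cong₂ _++_ (fvᵗ-ren ρ s) (fvᵗ-ren ρ t)) (sym (map-++ ρ (fvᵗ s) (fvᵗ t))))
  fvᵇ-ren {ρ} inj (c ∧ d) {y} y∈ = subst (y ∈_) (sym (map-++ ρ (fvᵇ c) (fvᵇ d)))
    ([ ∈-++⁺ˡ ∘ fvᵇ-ren inj c , ∈-++⁺ʳ _ ∘ fvᵇ-ren inj d ]′ (∈-++⁻ _ y∈))
  fvᵇ-ren {ρ} inj (ex x c) y∈
    with y∈c , y≢ρx ← ∈-filter⁻ (λ y → ¬? (y ≟ ρ x)) y∈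
    with z , z∈c , refl ← ∈-map⁻ ρ (fvᵇ-ren inj c y∈c) =
    ∈-map⁺ ρ (∈-filter⁺ (λ y → ¬? (y ≟ x)) z∈c (y≢ρx ∘ cong ρ))

  fv-⋀ : ∀ d → fvᶠ {S} (⋀ d) ≡ concatMap fvᵇ d
  fv-⋀ []      = refl
  fv-⋀ (c ∷ d) = cong (fvᵇ c ++_) (fv-⋀ d)

  fv-∃ᶠ : ∀ xs {φ} → fvᶠ {S} (∃ᶠ[ xs ] φ) ⊆ fvᶠ φ
  fv-∃ᶠ []       y∈ = y∈
  fv-∃ᶠ (x ∷ xs) y∈ = fv-∃ᶠ xs (proj₁ (∈-filter⁻ (λ y → ¬? (y ≟ x)) y∈))

  fv-equations : ∀ {n} (ss ts : Vec (Term S) n) →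
                 concatMap fvᵇ (equations ss ts) ⊆ fvᵗˢ ss ++ fvᵗˢ ts
  fv-equations []       []       ()
  fv-equations (s ∷ ss) (t ∷ ts) y∈ with ∈-++⁻ (fvᵗ s ++ fvᵗ t) y∈
  ... | inj₁ y∈st = [ ∈-++⁺ˡ ∘ ∈-++⁺ˡ , ∈-++⁺ʳ (fvᵗˢ (s ∷ ss)) ∘ ∈-++⁺ˡ ]′ (∈-++⁻ (fvᵗ s) y∈st)
  ... | inj₂ y∈E  = [ ∈-++⁺ˡ ∘ ∈-++⁺ʳ (fvᵗ s) , ∈-++⁺ʳ (fvᵗˢ (s ∷ ss)) ∘ ∈-++⁺ʳ (fvᵗ t) ]′
                      (∈-++⁻ (fvᵗˢ ss) (fv-equations ss ts y∈E))

  module _ {Π : Language S} where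

    fv-heads-ren : ∀ ρ (H : List (UserAtom S Π)) →
                   concatMap fvᵘ (map (renᵘ ρ) H) ≡ map ρ (concatMap fvᵘ H)
    fv-heads-ren ρ []                      = refl
    fv-heads-ren ρ (h@(user-atom _ _ ts) ∷ H) =
      trans (cong₂ _++_ (fvᵗˢ-ren ρ ts) (fv-heads-ren ρ H))
            (sym (map-++ ρ (fvᵗˢ ts) (concatMap fvᵘ H)))

    fvᶜ-ren : ∀ {ρ} → Injective _≡_ _≡_ ρ → (c : Constraint S Π) →
              fvᶜ (renᶜ ρ c) ⊆ map ρ (fvᶜ c)
    fvᶜ-ren inj (builtin c)                 = fvᵇ-ren inj c
    fvᶜ-ren {ρ} inj (user (user-atom _ _ ts)) {y} = subst (y ∈_) (fvᵗˢ-ren ρ ts)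

    fv-≐ : ∀ {H H′ : List (UserAtom S Π)} {E} → H ≐ H′ ↝ E →
           concatMap fvᵇ E ⊆ concatMap fvᵘ H ++ concatMap fvᵘ H′
    fv-≐ (_∷_ ts ts′ {H} {H′} eqs) y∈ with concatMap-++⁻ fvᵇ (equations ts ts′) y∈
    ... | inj₁ y∈ts = [ ∈-++⁺ˡ ∘ ∈-++⁺ˡ , ∈-++⁺ʳ (fvᵗˢ ts ++ concatMap fvᵘ H) ∘ ∈-++⁺ˡ ]′
                        (∈-++⁻ (fvᵗˢ ts) (fv-equations ts ts′ y∈ts))
    ... | inj₂ y∈E  = [ ∈-++⁺ˡ ∘ ∈-++⁺ʳ (fvᵗˢ ts)
                      , ∈-++⁺ʳ (fvᵗˢ ts ++ concatMap fvᵘ H) ∘ ∈-++⁺ʳ (fvᵗˢ ts′) ]′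
                        (∈-++⁻ (concatMap fvᵘ H) (fv-≐ eqs y∈E))

    ≐-length : ∀ {H H′ : List (UserAtom S Π)} {E} → H ≐ H′ ↝ E → length H ≡ length H′
    ≐-length []            = refl
    ≐-length (_∷_ _ _ eqs) = cong suc (≐-length eqs)

    fvₛ⁻ : ∀ s {x} → x ∈ fvₛ {S} {Π} s →
           x ∈ fvᵍ (Config.goal s) ⊎ x ∈ concatMap fvᵘ (Config.store s) ⊎
           x ∈ concatMap fvᵇ (Config.built s)
    fvₛ⁻ ⟨ G , K , d ⟩ x∈ with ∈-++⁻ (fvᵍ G) x∈
    ... | inj₁ x∈G  = inj₁ x∈G
    ... | inj₂ x∈Kd = inj₂ (∈-++⁻ (concatMap fvᵘ K) x∈Kd)

    module _ {W : List Var} {r : Rule S Π} (v : FreshRenaming W r) where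
      open FreshRenaming v

      head-fresh : ∀ {x} → x ∈ concatMap fvᵘ head → x ∉ W
      head-fresh {x} x∈
        with z , z∈ , refl ← ∈-map⁻ ρ (subst (x ∈_) (fv-heads-ren ρ (Rule.head r)) x∈) =
        fresh (∈-++⁺ˡ z∈)

      guard-fresh : ∀ {x} → x ∈ concatMap fvᵇ guard → x ∉ W
      guard-fresh x∈
        with z , z∈ , refl ← ∈-map⁻ ρ (concatMap-map-⊆ (fvᵇ-ren injective) (Rule.guard r) x∈) =
        fresh (∈-++⁺ʳ (concatMap fvᵘ (Rule.head r)) (∈-++⁺ˡ z∈))

      body-fresh : ∀ {x} → x ∈ fvᵍ body → x ∉ W
      body-fresh x∈
        with z , z∈ , refl ← ∈-map⁻ ρ (concatMap-map-⊆ (fvᶜ-ren injective) (Rule.body r) x∈) =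
        fresh (∈-++⁺ʳ (concatMap fvᵘ (Rule.head r)) (∈-++⁺ʳ (concatMap fvᵇ (Rule.guard r)) z∈))

      -- Lets a component with a smaller history reuse the renaming that the whole derivation chose.
      restrict : ∀ {W′} → W′ ⊆ W → FreshRenaming W′ r
      restrict W′⊆W = record { ρ = ρ ; injective = injective ; fresh = λ x∈ → fresh x∈ ∘ W′⊆W }

-- Satisfaction, existential blocks and renaming.

Agree : {A : Set} → List Var → (Var → A) → (Var → A) → Set
Agree V σ τ = ∀ {x} → x ∈ V → σ x ≡ τ x

module _ {S : Signature} (M : Structure S) where
  open Structure M

  mutual
    eval-cong : ∀ t {σ τ} → Agree (fvᵗ t) σ τ → eval M σ t ≡ eval M τ t
    eval-cong (var x)    σ≈τ = σ≈τ (here refl)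
    eval-cong (app f ts) σ≈τ = cong ⟦ f ⟧ᶠ (evals-cong ts σ≈τ)

    evals-cong : ∀ {n} (ts : Vec (Term S) n) {σ τ} → Agree (fvᵗˢ ts) σ τ →
                 evals M σ ts ≡ evals M τ ts
    evals-cong []       σ≈τ = refl
    evals-cong (t ∷ ts) σ≈τ =
      cong₂ _∷_ (eval-cong t (σ≈τ ∘ ∈-++⁺ˡ)) (evals-cong ts (σ≈τ ∘ ∈-++⁺ʳ (fvᵗ t)))

  update-cong : ∀ xs {x c σ τ} → Agree (_without_ {S} xs x) σ τ →
                Agree xs (_[_↦_] M σ x c) (_[_↦_] M τ x c)
  update-cong xs {x} σ≈τ {y} y∈ with y ≟ x
  ... | yes _  = refl
  ... | no y≢x = σ≈τ (∈-filter⁺ (λ z → ¬? (z ≟ x)) y∈ y≢x)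

  Sat-cong : ∀ φ {σ τ} → Agree (fvᶠ φ) σ τ → Sat M σ φ → Sat M τ φ
  Sat-cong (atom (rel r ts)) σ≈τ s       = subst ⟦ r ⟧ʳ (evals-cong ts σ≈τ) s
  Sat-cong (atom (t ≐ u))    σ≈τ s       =
    subst₂ _≈_ (eval-cong t (σ≈τ ∘ ∈-++⁺ˡ)) (eval-cong u (σ≈τ ∘ ∈-++⁺ʳ (fvᵗ t))) s
  Sat-cong true              σ≈τ s       = s
  Sat-cong (φ ∧ ψ)           σ≈τ (s , t) =
    Sat-cong φ (σ≈τ ∘ ∈-++⁺ˡ) s , Sat-cong ψ (σ≈τ ∘ ∈-++⁺ʳ (fvᶠ φ)) t
  Sat-cong (φ ∨ ψ)           σ≈τ (inj₁ s) = inj₁ (Sat-cong φ (σ≈τ ∘ ∈-++⁺ˡ) s)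
  Sat-cong (φ ∨ ψ)           σ≈τ (inj₂ s) = inj₂ (Sat-cong ψ (σ≈τ ∘ ∈-++⁺ʳ (fvᶠ φ)) s)
  Sat-cong (φ ⇒ ψ)           σ≈τ s       =
    Sat-cong ψ (σ≈τ ∘ ∈-++⁺ʳ (fvᶠ φ)) ∘ s ∘ Sat-cong φ (sym ∘ σ≈τ ∘ ∈-++⁺ˡ)
  Sat-cong (all x φ)         σ≈τ s       = λ c → Sat-cong φ (update-cong (fvᶠ φ) σ≈τ) (s c)
  Sat-cong (ex x φ)          σ≈τ (c , s) = c , Sat-cong φ (update-cong (fvᶠ φ) σ≈τ) s

  ⋀-cong : ∀ d {σ τ} → Agree (concatMap fvᵇ d) σ τ → Sat M σ (⋀ d) → Sat M τ (⋀ d)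
  ⋀-cong d σ≈τ = Sat-cong (⋀ d) (λ {x} → σ≈τ ∘ subst (x ∈_) (fv-⋀ d))

  ⋀-++⁺ : ∀ d {e σ} → Sat M σ (⋀ d) → Sat M σ (⋀ e) → Sat M σ (⋀ (d ++ e))
  ⋀-++⁺ []      _       t = t
  ⋀-++⁺ (c ∷ d) (s , u) t = s , ⋀-++⁺ d u t

  ⋀-++⁻ : ∀ d {e σ} → Sat M σ (⋀ (d ++ e)) → Sat M σ (⋀ d) × Sat M σ (⋀ e)
  ⋀-++⁻ []      t       = tt , t
  ⋀-++⁻ (c ∷ d) (s , t) with u , v ← ⋀-++⁻ d t = (s , u) , v

  ∃ᶠ⁻ : ∀ xs φ {σ} → Sat M σ (∃ᶠ[ xs ] φ) →
        ∃[ τ ] (∀ {x} → x ∉ xs → τ x ≡ σ x) × Sat M τ φ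
  ∃ᶠ⁻ []       φ {σ} s = σ , (λ _ → refl) , s
  ∃ᶠ⁻ (x ∷ xs) φ {σ} (c , s) with τ , τ≈ , t ← ∃ᶠ⁻ xs φ s =
    τ , (λ y∉ → trans (τ≈ (y∉ ∘ there)) (update-≢ (y∉ ∘ here))) , t
    where
    update-≢ : ∀ {y} → y ≢ x → _[_↦_] M σ x c y ≡ σ y
    update-≢ {y} y≢x with y ≟ x
    ... | yes y≡x = contradiction y≡x y≢x
    ... | no  _   = refl

  ∃ᶠ⁺ : ∀ xs φ {σ τ} → (∀ {x} → x ∉ xs → τ x ≡ σ x) → Sat M τ φ → Sat M σ (∃ᶠ[ xs ] φ)
  -- Here `τ` and `σ` agree at every variable, but only pointwise; `Sat-cong` takes the place of
  -- function extensionality.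
  ∃ᶠ⁺ []       φ         τ≈ s = Sat-cong φ (λ _ → τ≈ (λ ())) s
  ∃ᶠ⁺ (x ∷ xs) φ {σ} {τ} τ≈ s = τ x , ∃ᶠ⁺ xs φ off s
    where
    off : ∀ {y} → y ∉ xs → τ y ≡ _[_↦_] M σ x (τ x) y
    off {y} y∉ with y ≟ x
    ... | yes refl = refl
    ... | no  y≢x  = τ≈ λ { (here y≡x) → y≢x y≡x ; (there y∈) → y∉ y∈ }

  ∃₋⁻ : ∀ V φ {σ} → Sat M σ (∃₋[ V ] φ) → ∃[ τ ] Agree V τ σ × Sat M τ φ
  ∃₋⁻ V φ s with τ , τ≈ , t ← ∃ᶠ⁻ (filter (λ x → ¬? (x ∈? V)) (fvᶠ φ)) φ s =
    τ , (λ x∈V → τ≈ λ x∈ → proj₂ (∈-filter⁻ (λ x → ¬? (x ∈? V)) {xs = fvᶠ φ} x∈) x∈V) , t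

  ∃₋⁺ : ∀ V φ {σ} → Sat M σ φ → Sat M σ (∃₋[ V ] φ)
  ∃₋⁺ V φ = ∃ᶠ⁺ (filter (λ x → ¬? (x ∈? V)) (fvᶠ φ)) φ (λ _ → refl)

  mutual
    eval-ren : ∀ ρ t {σ} → eval M σ (renᵗ ρ t) ≡ eval M (σ ∘ ρ) t
    eval-ren ρ (var x)    = refl
    eval-ren ρ (app f ts) = cong ⟦ f ⟧ᶠ (evals-ren ρ ts)

    evals-ren : ∀ {n} ρ (ts : Vec (Term S) n) {σ} →
                evals M σ (renᵗˢ ρ ts) ≡ evals M (σ ∘ ρ) ts
    evals-ren ρ []       = refl
    evals-ren ρ (t ∷ ts) = cong₂ _∷_ (eval-ren ρ t) (evals-ren ρ ts)

  -- Injectivity keeps an update at `ρ x` from touching `ρ y` for any other `y`.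
  update-ren : ∀ {ρ} → Injective _≡_ _≡_ ρ → ∀ {σ x c} y →
               _[_↦_] M σ (ρ x) c (ρ y) ≡ _[_↦_] M (σ ∘ ρ) x c y
  update-ren {ρ} inj {x = x} y with ρ y ≟ ρ x | y ≟ x
  ... | yes _  | yes _   = refl
  ... | yes eq | no y≢x  = contradiction (inj eq) y≢x
  ... | no neq | yes eq  = contradiction (cong ρ eq) neq
  ... | no _   | no _    = refl

  module _ {ρ : Var → Var} (inj : Injective _≡_ _≡_ ρ) where

    Sat-ren⁻ : ∀ c {σ} → Sat M σ ⌊ renᵇ ρ c ⌋ → Sat M (σ ∘ ρ) ⌊ c ⌋
    Sat-ren⁻ (atom (rel r ts)) s       = subst ⟦ r ⟧ʳ (evals-ren ρ ts) s
    Sat-ren⁻ (atom (t ≐ u))    s       = subst₂ _≈_ (eval-ren ρ t) (eval-ren ρ u) s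
    Sat-ren⁻ (c ∧ d)           (s , t) = Sat-ren⁻ c s , Sat-ren⁻ d t
    Sat-ren⁻ (ex x c)          (e , s) =
      e , Sat-cong ⌊ c ⌋ (λ {y} _ → update-ren inj y) (Sat-ren⁻ c s)

    Sat-ren⁺ : ∀ c {σ} → Sat M (σ ∘ ρ) ⌊ c ⌋ → Sat M σ ⌊ renᵇ ρ c ⌋
    Sat-ren⁺ (atom (rel r ts)) s       = subst ⟦ r ⟧ʳ (sym (evals-ren ρ ts)) s
    Sat-ren⁺ (atom (t ≐ u))    s       =
      subst₂ _≈_ (sym (eval-ren ρ t)) (sym (eval-ren ρ u)) s
    Sat-ren⁺ (c ∧ d)           (s , t) = Sat-ren⁺ c s , Sat-ren⁺ d t
    Sat-ren⁺ (ex x c)          (e , s) =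
      e , Sat-ren⁺ c (Sat-cong ⌊ c ⌋ (λ {y} _ → sym (update-ren inj y)) s)

    ⋀-ren⁻ : ∀ d {σ} → Sat M σ (⋀ (map (renᵇ ρ) d)) → Sat M (σ ∘ ρ) (⋀ d)
    ⋀-ren⁻ []      _       = tt
    ⋀-ren⁻ (c ∷ d) (s , t) = Sat-ren⁻ c s , ⋀-ren⁻ d t

    ⋀-ren⁺ : ∀ d {σ} → Sat M (σ ∘ ρ) (⋀ d) → Sat M σ (⋀ (map (renᵇ ρ) d))
    ⋀-ren⁺ []      _       = tt
    ⋀-ren⁺ (c ∷ d) (s , t) = Sat-ren⁺ c s , ⋀-ren⁺ d t

  -- The left sides are two renamed copies of one head, on which the valuations correspond through
  -- the renamings; the right sides come from the store and are not renamed, so plain agreement is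
  -- asked there.
  equations-ren : ∀ {n} ρ ρ′ (ss ts : Vec (Term S) n) {σ σ′} →
                  (∀ z → σ (ρ z) ≡ σ′ (ρ′ z)) → Agree (fvᵗˢ ts) σ σ′ →
                  Sat M σ (⋀ (equations (renᵗˢ ρ ss) ts)) →
                  Sat M σ′ (⋀ (equations (renᵗˢ ρ′ ss) ts))
  equations-ren ρ ρ′ []       []       ρ≈ σ≈ s = tt
  equations-ren ρ ρ′ (t ∷ ss) (u ∷ ts) ρ≈ σ≈ (s , rest) =
    subst₂ _≈_
      (trans (eval-ren ρ t) (trans (eval-cong t (λ {z} _ → ρ≈ z)) (sym (eval-ren ρ′ t))))
      (eval-cong u (σ≈ ∘ ∈-++⁺ˡ)) s
    , equations-ren ρ ρ′ ss ts ρ≈ (σ≈ ∘ ∈-++⁺ʳ (fvᵗ u)) rest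

  -- Stated for a renaming that `σ` does not notice, because `renᵗˢ id ts` does not reduce to `ts`.
  equations-refl : IsEquality M → ∀ {n} ρ (ts : Vec (Term S) n) {σ} → (∀ x → σ (ρ x) ≡ σ x) →
                   Sat M σ (⋀ (equations (renᵗˢ ρ ts) ts))
  equations-refl eq ρ []       σρ = tt
  equations-refl eq ρ (t ∷ ts) {σ} σρ =
    subst (_≈ eval M σ t)
      (sym (trans (eval-ren ρ t) (eval-cong t (λ {x} _ → σρ x))))
      (IsEquivalence.refl (IsEquality.isEquivalence eq))
    , equations-refl eq ρ ts σρ

-- Renaming a rule apart from a larger history.

module _ {S : Signature} {Π : Language S} where

  -- Renaming keeps predicate symbols, so the second copy of the head matches the same `H′` with the
  -- same pairing.
  ≐-ren : ∀ ρ ρ′ (H : List (UserAtom S Π)) {H′ E} → map (renᵘ ρ) H ≐ H′ ↝ E →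
          ∃[ E′ ] (map (renᵘ ρ′) H ≐ H′ ↝ E′) ×
          (∀ M {σ σ′} → (∀ z → σ (ρ z) ≡ σ′ (ρ′ z)) → Agree (concatMap fvᵘ H′) σ σ′ →
           Sat M σ (⋀ E) → Sat M σ′ (⋀ E′))
  ≐-ren ρ ρ′ []                      []            = [] , [] , λ _ _ _ → id
  ≐-ren ρ ρ′ (user-atom _ _ ts ∷ H) (_∷_ _ us eqs)
    with E′ , eqs′ , E⇒E′ ← ≐-ren ρ ρ′ H eqs =
    _ , _∷_ _ us eqs′ , λ M ρ≈ σ≈ s →
      let s₁ , s₂ = ⋀-++⁻ M (equations (renᵗˢ ρ ts) us) s in
      ⋀-++⁺ M (equations (renᵗˢ ρ′ ts) us)
        (equations-ren M ρ ρ′ ts us ρ≈ (σ≈ ∘ ∈-++⁺ˡ) s₁)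
        (E⇒E′ M ρ≈ (σ≈ ∘ ∈-++⁺ʳ (fvᵗˢ us)) s₂)

-- Composed after a renaming fresh for `U`, such a `π` gives one fresh for `W`, while whatever
-- mentions only `U` stays as it is.
record Displacement (U W : List Var) : Set where
  field
    π π⁻¹    : Var → Var
    inverseˡ : ∀ x → π⁻¹ (π x) ≡ x
    fixes    : ∀ {x} → x ∈ U → π x ≡ x
    avoids   : ∀ {x} → x ∉ U → π x ∉ W

  injective : Injective _≡_ _≡_ π
  injective {x} {y} eq = trans (sym (inverseˡ x)) (trans (cong π⁻¹ eq) (inverseˡ y))

displace : ∀ {U W} → U ⊆ W → Displacement U W
displace {U} {W} U⊆W = record
  { π = π ; π⁻¹ = π⁻¹ ; inverseˡ = inverseˡ ; fixes = fixes ; avoids = avoids }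
  where
  -- The successor makes every shifted variable, even `0 + N`, exceed all of `W`; the maximum of an
  -- empty `W` defaults to `0`.
  N = suc (max 0 W)

  large∉W : ∀ x → x + N ∉ W
  large∉W x x+N∈W = <⇒≱ (m≤n+m N x) (All.lookup (xs≤max 0 W) x+N∈W)

  π π⁻¹ : Var → Var
  π x with x ∈? U
  ... | yes _ = x
  ... | no  _ = x + N
  π⁻¹ y with y ∈? U
  ... | yes _ = y
  ... | no  _ = y ∸ N

  inverseˡ : ∀ x → π⁻¹ (π x) ≡ x
  inverseˡ x with x ∈? U
  inverseˡ x | yes x∈ with x ∈? U
  ... | yes _  = refl
  ... | no  x∉ = contradiction x∈ x∉
  inverseˡ x | no _ with x + N ∈? U
  -- A shifted variable inside `U` would be mistaken by `π⁻¹` for a fixed one; `U ⊆ W` excludes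
  -- this.
  ... | yes x+N∈ = contradiction (U⊆W x+N∈) (large∉W x)
  ... | no  _    = m+n∸n≡m x N

  fixes : ∀ {x} → x ∈ U → π x ≡ x
  fixes {x} x∈ with x ∈? U
  ... | yes _  = refl
  ... | no  x∉ = contradiction x∈ x∉

  avoids : ∀ {x} → x ∉ U → π x ∉ W
  avoids {x} x∉ with x ∈? U
  ... | yes x∈ = contradiction x∈ x∉
  ... | no  _  = large∉W x

module _ {S : Signature} (CT : Theory S) {Π : Language S} where

  -- Finality of a projected derivation needs this: a rule renamed apart from its
  -- smaller history U need not avoid the history W of the full derivation.
  refresh : ∀ {U W d} {r : Rule S Π} (U⊆W : U ⊆ W) (v : FreshRenaming U r)
            (let open FreshRenaming v) {H′ E} →
            concatMap fvᵘ H′ ⊆ U → concatMap fvᵇ d ⊆ U →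
            head ≐ H′ ↝ E → Applicable CT {Π} d head E guard →
            ∃[ v′ ] ∃[ E′ ] (FreshRenaming.head {W = W} {r} v′ ≐ H′ ↝ E′) ×
                    Applicable CT {Π} d (FreshRenaming.head v′) E′ (FreshRenaming.guard v′)
  refresh {U} {W} {d} {r} U⊆W v {H′} {E} H′⊆U d⊆U eqs applies =
    v′ , E′ , eqs′ , app′
    where
    open FreshRenaming v
    open Displacement (displace U⊆W) using (π; π⁻¹; inverseˡ; fixes; avoids)
      renaming (injective to π-injective)

    v′ : FreshRenaming W r
    v′ = record
      { ρ = π ∘ ρ ; injective = injective ∘ π-injective ; fresh = λ x∈ → avoids (fresh x∈) }

    renamed = ≐-ren ρ (π ∘ ρ) (Rule.head r) eqs
    E′      = proj₁ renamed
    eqs′    = proj₁ (proj₂ renamed)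

    X′ = concatMap fvᵘ (FreshRenaming.head v′)

    π-head : ∀ {z} → z ∈ concatMap fvᵘ head → π z ∈ X′
    π-head {z} z∈
      with x , x∈ , refl ← ∈-map⁻ ρ (subst (z ∈_) (fv-heads-ren ρ (Rule.head r)) z∈) =
      subst (π z ∈_) (sym (fv-heads-ren (π ∘ ρ) (Rule.head r))) (∈-map⁺ (π ∘ ρ) x∈)

    app′ : Applicable CT {Π} d (FreshRenaming.head v′) E′ (FreshRenaming.guard v′)
    -- The old applicability is used at `σ ∘ π`, which reads each variable where `π` has moved it;
    -- `d` does not see the difference, as `π` fixes its variables.
    app′ M model σ σ⊨d
      with τ , τ≈ , τ⊨E , τ⊨C ← ∃ᶠ⁻ M (concatMap fvᵘ head) (⋀ E ∧ ⋀ guard)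
             (applies M model (σ ∘ π) (⋀-cong M d (λ {x} x∈ → cong σ (sym (fixes (d⊆U x∈)))) σ⊨d)) =
      ∃ᶠ⁺ M X′ (⋀ E′ ∧ ⋀ (FreshRenaming.guard v′)) off
        ( proj₂ (proj₂ renamed) M (λ z → sym (τ′-π (ρ z)))
            (λ {x} x∈ → trans (sym (τ′-π x)) (cong τ′ (fixes (H′⊆U x∈)))) τ⊨E
        , ⋀-ren⁺ M (FreshRenaming.injective v′) (Rule.guard r)
            (⋀-cong M (Rule.guard r) (λ {x} _ → sym (τ′-π (ρ x)))
              (⋀-ren⁻ M injective (Rule.guard r) τ⊨C)))
      where
      -- On the new head variables the values of `τ` are carried along `π`. Any other `z` has `τ z`
      -- equal to `σ (π z)`, so `τ′ ∘ π` agrees with `τ` everywhere.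
      τ′ : Valuation M
      τ′ y with y ∈? X′
      ... | yes _ = τ (π⁻¹ y)
      ... | no  _ = σ y

      off : ∀ {y} → y ∉ X′ → τ′ y ≡ σ y
      off {y} y∉ with y ∈? X′
      ... | yes y∈ = contradiction y∈ y∉
      ... | no  _  = refl

      τ′-π : ∀ z → τ′ (π z) ≡ τ z
      τ′-π z with π z ∈? X′
      ... | yes _   = cong τ (inverseˡ z)
      ... | no  πz∉ = sym (τ≈ (πz∉ ∘ π-head))

  -- Splitting a configuration into two components.

  -- Validity under `CT` of `d` with all variables outside `V` existentially quantified: what an
  -- answer equivalent to `true` provides.
  Satisfiable[_] : List Var → Builtins S → Set₁
  Satisfiable[ V ] d = ∀ M → Model CT M → ∀ σ → ∃[ τ ] Agree V τ σ × Sat M τ (⋀ d)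

  open Config

  -- The state (W , c) is composed of (W₁ , s₁) and (W₂ , s₂), which share only
  -- variables of V.  The built-in store of c is described up to equivalence, since
  -- Solve may replace it by any equivalent one.
  record Split (V W : List Var) (c : Config S Π) (W₁ : List Var) (s₁ : Config S Π)
               (W₂ : List Var) (s₂ : Config S Π) : Set₁ where
    field
      goals   : goal c ↭ goal s₁ ++ goal s₂
      stores  : store c ↭ store s₁ ++ store s₂
      built⁻  : ∀ M → Model CT M → ∀ σ → Sat M σ (⋀ (built c)) →
                Sat M σ (⋀ (built s₁)) × Sat M σ (⋀ (built s₂))
      built⁺  : ∀ M → Model CT M → ∀ σ → Sat M σ (⋀ (built s₁)) → Sat M σ (⋀ (built s₂)) →
                Sat M σ (⋀ (built c))
      fv₁     : fvₛ s₁ ⊆ W₁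
      fv₂     : fvₛ s₂ ⊆ W₂
      W₁⊆W    : W₁ ⊆ W
      W₂⊆W    : W₂ ⊆ W
      shared : ∀ {x} → x ∈ W₁ → x ∈ W₂ → x ∈ V

  Split-swap : ∀ {V W c W₁ s₁ W₂ s₂} → Split V W c W₁ s₁ W₂ s₂ → Split V W c W₂ s₂ W₁ s₁
  Split-swap {s₁ = s₁} sp = record
    { goals   = ↭-trans goals (++-comm (goal s₁) _)
    ; stores  = ↭-trans stores (++-comm (store s₁) _)
    ; built⁻  = λ M m σ → swap ∘ built⁻ M m σ
    ; built⁺  = λ M m σ s t → built⁺ M m σ t s
    ; fv₁     = fv₂
    ; fv₂     = fv₁
    ; W₁⊆W    = W₂⊆W
    ; W₂⊆W    = W₁⊆W
    ; shared = λ x∈ y∈ → shared y∈ x∈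
    }
    where open Split sp

  module _ {V W c W₁ s₁ W₂ s₂} (sp : Split V W c W₁ s₁ W₂ s₂) where
    open Split sp

    -- Only the first component moves; moves of the second are expressed through `Split-swap`.
    Progress : List (Rule S Π) → Config S Π → Set₁
    Progress Q c′ = ∃[ s₁′ ] Step CT Q W₁ s₁ s₁′ ×
                    Split V (fvₛ c′ ++ W) c′ (fvₛ s₁′ ++ W₁) s₁′ W₂ s₂

    -- By the last hypothesis, variables new to the first component are also new to `W`, hence
    -- outside `W₂`: the components come to share nothing more.
    advance : ∀ {c′ s₁′} →
      goal c′ ↭ goal s₁′ ++ goal s₂ → store c′ ↭ store s₁′ ++ store s₂ →
      (∀ M → Model CT M → ∀ σ → Sat M σ (⋀ (built c′)) →
       Sat M σ (⋀ (built s₁′)) × Sat M σ (⋀ (built s₂))) →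
      (∀ M → Model CT M → ∀ σ → Sat M σ (⋀ (built s₁′)) → Sat M σ (⋀ (built s₂)) →
       Sat M σ (⋀ (built c′))) →
      (∀ {x} → x ∈ fvₛ s₁′ → x ∈ W₁ ⊎ (x ∉ W × x ∈ fvₛ c′)) →
      Split V (fvₛ c′ ++ W) c′ (fvₛ s₁′ ++ W₁) s₁′ W₂ s₂
    advance {c′} {s₁′} g s b⁻ b⁺ new = record
      { goals   = g
      ; stores  = s
      ; built⁻  = b⁻
      ; built⁺  = b⁺
      ; fv₁     = ∈-++⁺ˡ
      ; fv₂     = fv₂
      ; W₁⊆W    = [ [ ∈-++⁺ʳ (fvₛ c′) ∘ W₁⊆W , ∈-++⁺ˡ ∘ proj₂ ]′ ∘ new
                  , ∈-++⁺ʳ (fvₛ c′) ∘ W₁⊆W ]′ ∘ ∈-++⁻ (fvₛ s₁′)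
      ; W₂⊆W    = ∈-++⁺ʳ (fvₛ c′) ∘ W₂⊆W
      ; shared = λ x∈ x∈W₂ →
          [ [ (λ x∈W₁ → shared x∈W₁ x∈W₂) , (λ x∉ → contradiction (W₂⊆W x∈W₂) (proj₁ x∉)) ]′ ∘ new
          , (λ x∈W₁ → shared x∈W₁ x∈W₂) ]′ (∈-++⁻ (fvₛ s₁′) x∈)
      }

    goal⊆ : fvᵍ (goal s₁) ⊆ W₁
    goal⊆ = fv₁ ∘ ∈-++⁺ˡ

    store⊆ : concatMap fvᵘ (store s₁) ⊆ W₁
    store⊆ = fv₁ ∘ ∈-++⁺ʳ (fvᵍ (goal s₁)) ∘ ∈-++⁺ˡ

    built⊆ : concatMap fvᵇ (built s₁) ⊆ W₁
    built⊆ = fv₁ ∘ ∈-++⁺ʳ (fvᵍ (goal s₁)) ∘ ∈-++⁺ʳ (concatMap fvᵘ (store s₁))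

    matched⊆ : ∀ H′ {K′} → store s₁ ↭ H′ ++ K′ → concatMap fvᵘ H′ ⊆ W₁
    matched⊆ H′ p = store⊆ ∘ concatMap-⊆-↭ fvᵘ (↭-sym p) ∘ concatMap-++⁺ˡ fvᵘ H′

    -- The built-ins of s₂ can be satisfied for every value of the shared
    -- variables V, so they contribute nothing to a guard that does not mention
    -- the other variables of s₂.
    localise : ∀ {r H′ E} → Satisfiable[ V ] (built c) → (v : FreshRenaming W r)
               (let open FreshRenaming v) → concatMap fvᵘ H′ ⊆ W₁ → head ≐ H′ ↝ E →
               Applicable CT {Π} (built c) head E guard → Applicable CT {Π} (built s₁) head E guard
    localise {r} {H′} {E} sat v H′⊆ eqs applies M m σ σ⊨s₁ =
      Sat-cong M γ (λ x∈ → σ′-off (γ∉W₂ x∈)) (applies M m σ′ (built⁺ M m σ′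
        (⋀-cong M (built s₁) (sym ∘ σ′-W₁ ∘ built⊆) σ⊨s₁)
        (⋀-cong M (built s₂)
           (sym ∘ σ′-W₂ ∘ fv₂ ∘ ∈-++⁺ʳ (fvᵍ (goal s₂)) ∘ ∈-++⁺ʳ (concatMap fvᵘ (store s₂)))
           (proj₂ (built⁻ M m τ τ⊨c)))))
      where
      open FreshRenaming v
      τ = proj₁ (sat M m σ)
      τ≈σ = proj₁ (proj₂ (sat M m σ))
      τ⊨c = proj₂ (proj₂ (sat M m σ))
      γ = ∃ᶠ[ concatMap fvᵘ head ] (⋀ E ∧ ⋀ guard)

      -- `τ` makes the built-ins of `s₂` true, and on `W₁ ∩ W₂ ⊆ V` it agrees with `σ`, so `σ′`
      -- still looks like `σ` from `W₁`. The variables of `γ` are in `W₁` or fresh, so its truth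
      -- returns to `σ`.
      σ′ : Valuation M
      σ′ x with x ∈? W₂
      ... | yes _ = τ x
      ... | no  _ = σ x

      σ′-off : ∀ {x} → x ∉ W₂ ⊎ x ∈ V → σ′ x ≡ σ x
      σ′-off {x} x∈ with x ∈? W₂ | x∈
      ... | no  _  | _       = refl
      ... | yes y∈ | inj₁ y∉ = contradiction y∈ y∉
      ... | yes _  | inj₂ x∈V = τ≈σ x∈V

      σ′-W₂ : ∀ {x} → x ∈ W₂ → σ′ x ≡ τ x
      σ′-W₂ {x} x∈ with x ∈? W₂
      ... | yes _  = refl
      ... | no  x∉ = contradiction x∈ x∉

      local : ∀ {x} → x ∈ W₁ → x ∉ W₂ ⊎ x ∈ V
      local {x} x∈ with x ∈? W₂
      ... | yes x∈W₂ = inj₂ (shared x∈ x∈W₂)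
      ... | no  x∉W₂ = inj₁ x∉W₂

      σ′-W₁ : ∀ {x} → x ∈ W₁ → σ′ x ≡ σ x
      σ′-W₁ = σ′-off ∘ local

      γ∉W₂ : ∀ {x} → x ∈ fvᶠ γ → x ∉ W₂ ⊎ x ∈ V
      γ∉W₂ {x} x∈ with ∈-++⁻ (fvᶠ (⋀ E)) (fv-∃ᶠ (concatMap fvᵘ head) {⋀ E ∧ ⋀ guard} x∈)
      ... | inj₂ x∈C = inj₁ (guard-fresh v (subst (x ∈_) (fv-⋀ guard) x∈C) ∘ W₂⊆W)
      ... | inj₁ x∈E with ∈-++⁻ (concatMap fvᵘ head) (fv-≐ eqs (subst (x ∈_) (fv-⋀ E) x∈E))
      ...   | inj₁ x∈H  = inj₁ (head-fresh v x∈H ∘ W₂⊆W)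
      ...   | inj₂ x∈H′ = local (H′⊆ x∈H′)

    -- Supplies the last hypothesis of `advance` when a rule fires: each variable is old to `s₁` or
    -- belongs to the renamed rule.
    fire-fv : ∀ {r H′ K₁′ E G d K₂} (v : FreshRenaming W r) (let open FreshRenaming v) →
              concatMap fvᵘ H′ ⊆ W₁ → concatMap fvᵘ K₁′ ⊆ W₁ → head ≐ H′ ↝ E →
              ∀ {x} → x ∈ fvₛ {S} {Π} ⟨ body ++ goal s₁ , K₁′ , E ++ built s₁ ⟩ →
              x ∈ W₁ ⊎ (x ∉ W × x ∈ fvₛ {S} {Π} ⟨ body ++ G , K₂ , E ++ d ⟩)
    fire-fv {K₁′ = K₁′} {E} {G} {d} {K₂} v H′⊆ K₁′⊆ eqs {x} x∈
      with fvₛ⁻ ⟨ FreshRenaming.body v ++ goal s₁ , K₁′ , E ++ built s₁ ⟩ x∈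
    ... | inj₂ (inj₁ x∈K) = inj₁ (K₁′⊆ x∈K)
    ... | inj₁ x∈G with concatMap-++⁻ fvᶜ (FreshRenaming.body v) x∈G
    ...   | inj₂ x∈G₁ = inj₁ (goal⊆ x∈G₁)
    ...   | inj₁ x∈B  = inj₂ (body-fresh v x∈B , ∈-++⁺ˡ (concatMap-++⁺ˡ fvᶜ (FreshRenaming.body v) x∈B))
    fire-fv {E = E} {G} {d} {K₂} v H′⊆ K₁′⊆ eqs {x} x∈
        | inj₂ (inj₂ x∈d) with concatMap-++⁻ fvᵇ E x∈d
    ...   | inj₂ x∈d₁ = inj₁ (built⊆ x∈d₁)
    ...   | inj₁ x∈E with ∈-++⁻ (concatMap fvᵘ (FreshRenaming.head v)) (fv-≐ eqs x∈E)
    ...     | inj₂ x∈H′ = inj₁ (H′⊆ x∈H′)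
    ...     | inj₁ x∈H  = inj₂ (head-fresh v x∈H ,
                ∈-++⁺ʳ (fvᵍ (FreshRenaming.body v ++ G)) (∈-++⁺ʳ (concatMap fvᵘ K₂)
                  (concatMap-++⁺ˡ fvᵇ E x∈E)))

    solve-left : ∀ {Q G′ G₁′ e d′} → goal s₁ ↭ builtin e ∷ G₁′ → G′ ↭ G₁′ ++ goal s₂ →
                 CT ⊨ ((⌊ e ⌋ ∧ ⋀ (built c)) ⇔ ⋀ d′) → Progress Q ⟨ G′ , store c , d′ ⟩
    solve-left {G₁′ = G₁′} {e} p q e∧d⇔d′ =
      -- Whichever equivalent `d′` the whole derivation chose, the component records the literal
      -- conjunction, whose variables stay within `W₁`.
      ⟨ G₁′ , store s₁ , e ∷ built s₁ ⟩ ,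
      solve p (λ _ _ _ → id , id) ,
      advance q stores
        (λ M m σ s → let t , u = proj₂ (e∧d⇔d′ M m σ) s ; u₁ , u₂ = built⁻ M m σ u in (t , u₁) , u₂)
        (λ M m σ (t , u₁) u₂ → proj₁ (e∧d⇔d′ M m σ) (t , built⁺ M m σ u₁ u₂))
        (inj₁ ∘ old)
      where
      goal′⊆ : fvᵍ (builtin e ∷ G₁′) ⊆ W₁
      goal′⊆ = goal⊆ ∘ concatMap-⊆-↭ fvᶜ (↭-sym p)

      old : fvₛ {S} {Π} ⟨ G₁′ , store s₁ , e ∷ built s₁ ⟩ ⊆ W₁
      old x∈ with fvₛ⁻ {Π = Π} ⟨ G₁′ , store s₁ , e ∷ built s₁ ⟩ x∈
      ... | inj₁ x∈G        = goal′⊆ (∈-++⁺ʳ (fvᵇ e) x∈G)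
      ... | inj₂ (inj₁ x∈K) = store⊆ x∈K
      ... | inj₂ (inj₂ x∈d) = [ goal′⊆ ∘ ∈-++⁺ˡ , built⊆ ]′ (∈-++⁻ (fvᵇ e) x∈d)

    introduce-left : ∀ {Q G′ G₁′ h} → goal s₁ ↭ user h ∷ G₁′ → G′ ↭ G₁′ ++ goal s₂ →
                     Progress Q ⟨ G′ , h ∷ store c , built c ⟩
    introduce-left {G₁′ = G₁′} {h} p q =
      ⟨ G₁′ , h ∷ store s₁ , built s₁ ⟩ ,
      introduce p ,
      advance q (prep h stores) built⁻ built⁺ (inj₁ ∘ old)
      where
      goal′⊆ : fvᵍ (user h ∷ G₁′) ⊆ W₁
      goal′⊆ = goal⊆ ∘ concatMap-⊆-↭ fvᶜ (↭-sym p)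

      old : fvₛ {S} {Π} ⟨ G₁′ , h ∷ store s₁ , built s₁ ⟩ ⊆ W₁
      old x∈ with fvₛ⁻ {Π = Π} ⟨ G₁′ , h ∷ store s₁ , built s₁ ⟩ x∈
      ... | inj₁ x∈G        = goal′⊆ (∈-++⁺ʳ (fvᵘ h) x∈G)
      ... | inj₂ (inj₁ x∈K) = [ goal′⊆ ∘ ∈-++⁺ˡ , store⊆ ]′ (∈-++⁻ (fvᵘ h) x∈K)
      ... | inj₂ (inj₂ x∈d) = built⊆ x∈d

    module _ {Q r H′ E} (r∈Q : r ∈ Q) (v : FreshRenaming W r)
             (eqs : FreshRenaming.head v ≐ H′ ↝ E) (sat : Satisfiable[ V ] (built c))
             (applies : Applicable CT {Π} (built c) (FreshRenaming.head v) E (FreshRenaming.guard v))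
             where
      open FreshRenaming v

      fire-left : ∀ {K₁′ K′} → concatMap fvᵘ H′ ⊆ W₁ → concatMap fvᵘ K₁′ ⊆ W₁ →
                  K′ ↭ K₁′ ++ store s₂ →
                  let s₁′ = ⟨ body ++ goal s₁ , K₁′ , E ++ built s₁ ⟩
                      c′  = ⟨ body ++ goal c , K′ , E ++ built c ⟩
                  in Split V (fvₛ c′ ++ W) c′ (fvₛ s₁′ ++ W₁) s₁′ W₂ s₂
      fire-left {K₁′} {K′} H′⊆ K₁′⊆ p = advance
        (↭-trans (++⁺ˡ body goals) (↭-sym (++-assoc body (goal s₁) (goal s₂))))
        p
        (λ M m σ s → let t , u = ⋀-++⁻ M E s ; u₁ , u₂ = built⁻ M m σ u in ⋀-++⁺ M E t u₁ , u₂)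
        (λ M m σ s u₂ → let t , u₁ = ⋀-++⁻ M E s in ⋀-++⁺ M E t (built⁺ M m σ u₁ u₂))
        (fire-fv {K₁′ = K₁′} {G = goal c} {d = built c} {K₂ = K′} v H′⊆ K₁′⊆ eqs)

      simplify-left : ∀ {K₁′ K′} → Rule.kind r ≡ simplification → store s₁ ↭ H′ ++ K₁′ →
                      K′ ↭ K₁′ ++ store s₂ → Progress Q ⟨ body ++ goal c , K′ , E ++ built c ⟩
      simplify-left {K₁′} kind p q =
        _ ,
        simplify r∈Q kind (restrict v W₁⊆W) p eqs (localise sat v (matched⊆ H′ p) eqs applies) ,
        fire-left (matched⊆ H′ p) (store⊆ ∘ concatMap-⊆-↭ fvᵘ (↭-trans (++-comm K₁′ H′) (↭-sym p))
                                       ∘ concatMap-++⁺ˡ fvᵘ K₁′) q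

      propagate-left : ∀ {K₁′} → Rule.kind r ≡ propagation → store s₁ ↭ H′ ++ K₁′ →
                       Progress Q ⟨ body ++ goal c , store c , E ++ built c ⟩
      propagate-left kind p =
        _ ,
        propagate r∈Q kind (restrict v W₁⊆W) p eqs (localise sat v (matched⊆ H′ p) eqs applies) ,
        fire-left (matched⊆ H′ p) store⊆ stores

  -- Splitting derivations with single-headed rules.

  length-head : ∀ {W r} (v : FreshRenaming W r) {H′ : List (UserAtom S Π)} {E} →
                FreshRenaming.head v ≐ H′ ↝ E → length (Rule.head r) ≡ length H′
  length-head {r = r} v eqs = trans (sym (length-map _ (Rule.head r))) (≐-length eqs)

  no-empty-match : ∀ {W r} (v : FreshRenaming W r) {H′ : List (UserAtom S Π)} {E} →
                   FreshRenaming.head v ≐ H′ ↝ E → H′ ≢ []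
  no-empty-match {r = r} v eqs refl =
    Rule.nonempty r (length-0 (Rule.head r) (length-head v eqs))
    where
    length-0 : ∀ (H : List (UserAtom S Π)) → length H ≡ 0 → H ≡ []
    length-0 [] _ = refl

  -- This is where single heads enter: one matched atom lies in the store of one component, whereas
  -- two could be taken from both.
  singleton-match : ∀ {W r} (v : FreshRenaming W r) {H′ : List (UserAtom S Π)} {E} →
                    HeadSize≤ S Π 1 r → FreshRenaming.head v ≐ H′ ↝ E → ∃[ h ] H′ ≡ h ∷ []
  singleton-match v {[]}        _    eqs = contradiction refl (no-empty-match v eqs)
  singleton-match v {h ∷ []}    _    eqs = h , refl
  singleton-match v {_ ∷ _ ∷ _} size eqs
    with s≤s () ← subst (_≤ 1) (length-head v eqs) size

  empty-final : ∀ {Q : List (Rule S Π)} {W d} → Final CT Q (W , ⟨ [] , [] , d ⟩)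
  empty-final _ (solve q _ , _)   = ¬x∷xs↭[] (↭-sym q)
  empty-final _ (introduce q , _) = ¬x∷xs↭[] (↭-sym q)
  empty-final _ (simplify {H′ = []}     _ _ v _ eqs _ , _)  = no-empty-match v eqs refl
  empty-final _ (simplify {H′ = _ ∷ _}  _ _ _ q _ _ , _)    = ¬x∷xs↭[] (↭-sym q)
  empty-final _ (propagate {H′ = []}    _ _ v _ eqs _ , _)  = no-empty-match v eqs refl
  empty-final _ (propagate {H′ = _ ∷ _} _ _ _ q _ _ , _)    = ¬x∷xs↭[] (↭-sym q)

  Split-step : ∀ {V W c c′ W₁ s₁ W₂ s₂} {Q : List (Rule S Π)} → All (HeadSize≤ S Π 1) Q →
               (sp : Split V W c W₁ s₁ W₂ s₂) → Satisfiable[ V ] (built c) →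
               Step CT Q W c c′ → Progress sp Q c′ ⊎ Progress (Split-swap sp) Q c′
  Split-step {s₁ = s₁} small sp sat (solve p e∧d⇔d′) with split-∷ (goal s₁) p (Split.goals sp)
  ... | inj₁ (_ , p₁ , q) = inj₁ (solve-left sp p₁ q e∧d⇔d′)
  ... | inj₂ (_ , p₂ , q) = inj₂ (solve-left (Split-swap sp) p₂ q e∧d⇔d′)
  Split-step {s₁ = s₁} small sp sat (introduce p) with split-∷ (goal s₁) p (Split.goals sp)
  ... | inj₁ (_ , p₁ , q) = inj₁ (introduce-left sp p₁ q)
  ... | inj₂ (_ , p₂ , q) = inj₂ (introduce-left (Split-swap sp) p₂ q)
  Split-step {s₁ = s₁} small sp sat (simplify r∈Q kind v p eqs applies)
    with _ , refl ← singleton-match v (All.lookup small r∈Q) eqs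
    with split-∷ (store s₁) p (Split.stores sp)
  ... | inj₁ (_ , p₁ , q) = inj₁ (simplify-left sp r∈Q v eqs sat applies kind p₁ q)
  ... | inj₂ (_ , p₂ , q) = inj₂ (simplify-left (Split-swap sp) r∈Q v eqs sat applies kind p₂ q)
  Split-step {s₁ = s₁} small sp sat (propagate r∈Q kind v p eqs applies)
    with _ , refl ← singleton-match v (All.lookup small r∈Q) eqs
    with split-∷ (store s₁) p (Split.stores sp)
  ... | inj₁ (_ , p₁ , q) = inj₁ (propagate-left sp r∈Q v eqs sat applies kind p₁)
  ... | inj₂ (_ , p₂ , q) = inj₂ (propagate-left (Split-swap sp) r∈Q v eqs sat applies kind p₂)

  -- Built-in stores only get stronger, so satisfiability of the last one passes back to all earlier
  -- ones, as `Split-step` requires.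
  Step-entails : ∀ {Q : List (Rule S Π)} {W c c′} → Step CT Q W c c′ →
                 ∀ M → Model CT M → ∀ σ → Sat M σ (⋀ (built c′)) → Sat M σ (⋀ (built c))
  Step-entails (solve _ e∧d⇔d′)             M m σ s = proj₂ (proj₂ (e∧d⇔d′ M m σ) s)
  Step-entails (introduce _)                M m σ s = s
  Step-entails (simplify {E = E} _ _ _ _ _ _)  M m σ s = proj₂ (⋀-++⁻ M E s)
  Step-entails (propagate {E = E} _ _ _ _ _ _) M m σ s = proj₂ (⋀-++⁻ M E s)

  Star-entails : ∀ {Q : List (Rule S Π)} {W c W′ c′} → Star (Transition CT Q) (W , c) (W′ , c′) →
                 ∀ M → Model CT M → ∀ σ → Sat M σ (⋀ (built c′)) → Sat M σ (⋀ (built c))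
  Star-entails ε                   M m σ s = s
  Star-entails ((step , refl) ◅ ts) M m σ s = Step-entails step M m σ (Star-entails ts M m σ s)

  Split-star : ∀ {V W c W′ c′ W₁ s₁ W₂ s₂} {Q : List (Rule S Π)} → All (HeadSize≤ S Π 1) Q →
               Split V W c W₁ s₁ W₂ s₂ → Satisfiable[ V ] (built c′) →
               Star (Transition CT Q) (W , c) (W′ , c′) →
               ∃[ W₁′ ] ∃[ s₁′ ] ∃[ W₂′ ] ∃[ s₂′ ]
                 Star (Transition CT Q) (W₁ , s₁) (W₁′ , s₁′) × Split V W′ c′ W₁′ s₁′ W₂′ s₂′
  Split-star small sp sat ε = _ , _ , _ , _ , ε , sp
  Split-star small sp sat ts@((step , refl) ◅ ts′)
    with Split-step small sp (λ M m σ → map₂ (map₂ (Star-entails ts M m _)) (sat M m σ)) step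
  ... | inj₁ (_ , step₁ , sp′)
    with _ , _ , _ , _ , us , sp″ ← Split-star small sp′ sat ts′ =
    _ , _ , _ , _ , (step₁ , refl) ◅ us , sp″
  -- A step of the second component leaves `s₁` as it was; swapping back restores the order.
  ... | inj₂ (_ , _ , sp′) = Split-star small (Split-swap sp′) sat ts′

  -- A rule applicable in the component would, once refreshed, apply in the whole: the store `K`
  -- contains `K₁`, and `d` entails `d₁`.
  Split-final : ∀ {V W K d W₁ K₁ d₁ W₂ s₂} {Q : List (Rule S Π)} →
                Split V W ⟨ [] , K , d ⟩ W₁ ⟨ [] , K₁ , d₁ ⟩ W₂ s₂ →
                Final CT Q (W , ⟨ [] , K , d ⟩) → Final CT Q (W₁ , ⟨ [] , K₁ , d₁ ⟩)
  Split-final sp final _ (solve p _ , _)   = ¬x∷xs↭[] (↭-sym p)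
  Split-final sp final _ (introduce p , _) = ¬x∷xs↭[] (↭-sym p)
  Split-final {d₁ = d₁} {s₂ = s₂} sp final _ (simplify {H′ = H′} r∈Q kind v p eqs applies , _)
    with v′ , E′ , eqs′ , applies′ ←
      refresh {d = d₁} (Split.W₁⊆W sp) v (matched⊆ sp H′ p) (built⊆ sp) eqs applies =
    final _ (simplify r∈Q kind v′
      (↭-trans (Split.stores sp) (↭-trans (++⁺ʳ (store s₂) p) (++-assoc H′ _ _)))
      eqs′ (λ M m σ → applies′ M m σ ∘ proj₁ ∘ Split.built⁻ sp M m σ) , refl)
  Split-final {d₁ = d₁} {s₂ = s₂} sp final _ (propagate {H′ = H′} r∈Q kind v p eqs applies , _)
    with v′ , E′ , eqs′ , applies′ ←
      refresh {d = d₁} (Split.W₁⊆W sp) v (matched⊆ sp H′ p) (built⊆ sp) eqs applies =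
    final _ (propagate r∈Q kind v′
      (↭-trans (Split.stores sp) (↭-trans (++⁺ʳ (store s₂) p) (++-assoc H′ _ _)))
      eqs′ (λ M m σ → applies′ M m σ ∘ proj₁ ∘ Split.built⁻ sp M m σ) , refl)

  -- `G` is `A ++ B` only up to permutation because that is how encodings are compositional. The
  -- splitting of `K` is kept so that an empty `K` forces an empty `K₁`.
  project : ∀ {Q : List (Rule S Π)} {G K d} → All (HeadSize≤ S Π 1) Q →
            ∀ A B → G ↭ A ++ B → Satisfiable[ fvᵍ G ] d → _⊢_⇓_,_ CT Q G K d →
            ∃[ K₁ ] ∃[ K₂ ] ∃[ d₁ ] K ↭ K₁ ++ K₂ × _⊢_⇓_,_ CT Q A K₁ d₁
  project {G = G} small A B p sat (W , ts , final)
    with Split-star small start sat ts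
    where
    A⊆G : fvᵍ A ⊆ fvᵍ G
    A⊆G = concatMap-⊆-↭ fvᶜ (↭-sym p) ∘ concatMap-++⁺ˡ fvᶜ A

    B⊆G : fvᵍ B ⊆ fvᵍ G
    B⊆G = concatMap-⊆-↭ fvᶜ (↭-trans (++-comm B A) (↭-sym p)) ∘ concatMap-++⁺ˡ fvᶜ B

    fv-start : ∀ A → fvₛ {S} {Π} ⟨ A , [] , [] ⟩ ⊆ fvᵍ A
    fv-start A x∈ = [ id , [ (λ ()) , (λ ()) ]′ ]′ (fvₛ⁻ {Π = Π} ⟨ A , [] , [] ⟩ x∈)

    start : Split (fvᵍ G) (fvᵍ G) ⟨ G , [] , [] ⟩ (fvᵍ A) ⟨ A , [] , [] ⟩ (fvᵍ B) ⟨ B , [] , [] ⟩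
    start = record
      { goals  = p
      ; stores = ↭-refl
      ; built⁻ = λ _ _ _ _ → tt , tt
      ; built⁺ = λ _ _ _ _ _ → tt
      ; fv₁    = fv-start A
      ; fv₂    = fv-start B
      ; W₁⊆W   = A⊆G
      ; W₂⊆W   = B⊆G
      -- Initially `V` is the set of all variables of `G`, so anything shared lies in it.
      ; shared = λ x∈ _ → A⊆G x∈
      }
  ... | W₁ , ⟨ [] , K₁ , d₁ ⟩ , _ , s₂ , us , sp =
    K₁ , store s₂ , d₁ , Split.stores sp , W₁ , us , Split-final sp final
  ... | _ , ⟨ _ ∷ _ , _ , _ ⟩ , _ , _ , _ , sp = contradiction (↭-sym (Split.goals sp)) ¬x∷xs↭[]

-- The separating source program.

module Source {S : Signature} (CT : Theory S) (equality : AllowsEquality CT)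
              {Π : Language S} (q : User S) (q∈Π : Π q)
              (c : Fun S) (nullary : fun-arity S c ≡ 0) where

  constant : Term S
  constant = app c (subst (Vec (Term S)) (sym nullary) [])

  closed : ∀ n → fvᵗˢ {S} (replicate n constant) ≡ []
  closed ℕ.zero  = refl
  closed (suc n) = trans (cong (_++ fvᵗˢ (replicate n constant)) constant-closed) (closed n)
    where
    empty : ∀ {n} → n ≡ 0 → (ts : Vec (Term S) n) → fvᵗˢ ts ≡ []
    empty refl [] = refl

    constant-closed : fvᵗ constant ≡ []
    constant-closed = empty nullary (subst (Vec (Term S)) (sym nullary) [])

  -- With the constant in every place `p` is ground, and `id` renames both rules apart from any
  -- history.
  args : Vec (Term S) (user-arity S q)
  args = replicate _ constant

  p : UserAtom S Π
  p = user-atom q q∈Π args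

  -- Without `loop` the goal p would have p itself as a qualified answer, and an
  -- inconsistent CT identifies all qualified answers.
  loop cancel : Rule S Π
  loop = record
    { kind = propagation ; head = p ∷ [] ; nonempty = λ () ; guard = [] ; body = [] }
  cancel = record
    { kind = simplification ; head = p ∷ p ∷ [] ; nonempty = λ () ; guard = [] ; body = [] }

  rules : List (Rule S Π)
  rules = loop ∷ cancel ∷ []

  program : ∀ {n} → n ≥ 2 → Program S Π n
  program n≥2 = rules , ≤-trans (s≤s z≤n) n≥2 ∷ n≥2 ∷ []

  p-closed : ∀ {x} → x ∉ fvᵘ p
  p-closed {x} x∈ with () ← subst (x ∈_) (closed (user-arity S q)) x∈

  loop-fresh : ∀ W → FreshRenaming W loop
  loop-fresh W = record { ρ = id ; injective = id ; fresh = λ x∈ →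
    ⊥-elim ([ [ p-closed , (λ ()) ]′ ∘ ∈-++⁻ (fvᵘ p) , (λ ()) ]′ (∈-++⁻ (concatMap fvᵘ (p ∷ [])) x∈)) }

  cancel-fresh : ∀ W → FreshRenaming W cancel
  cancel-fresh W = record { ρ = id ; injective = id ; fresh = λ x∈ →
    ⊥-elim ([ [ p-closed , [ p-closed , (λ ()) ]′ ∘ ∈-++⁻ (fvᵘ p) ]′ ∘ ∈-++⁻ (fvᵘ p) , (λ ()) ]′
      (∈-++⁻ (concatMap fvᵘ (p ∷ p ∷ [])) x∈)) }

  args≐args : Builtins S
  args≐args = equations (renᵗˢ id args) args

  args≐args-valid : ∀ M → Model CT M → ∀ σ → Sat M σ (⋀ args≐args)
  args≐args-valid M m σ = equations-refl M (equality M m) id args (λ _ → refl)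

  -- `pairing` and `cancelled` are the lists that matching `p, p` and then firing `cancel` on an
  -- empty built-in store compute to; hence the trailing `[]`.
  pairing : Builtins S
  pairing = args≐args ++ args≐args ++ []

  cancelled : Builtins S
  cancelled = pairing ++ []

  cancelled-valid : ∀ M → Model CT M → ∀ σ → Sat M σ (⋀ cancelled)
  cancelled-valid M m σ =
    ⋀-++⁺ M pairing
      (⋀-++⁺ M args≐args (args≐args-valid M m σ)
        (⋀-++⁺ M args≐args (args≐args-valid M m σ) tt))
      tt

  -- The invariant of derivations from the goal `p`: there is only ever one `p`, too few for
  -- `cancel`.
  data Pending : Config S Π → Set where
    in-goal  : ∀ {d} → Pending ⟨ user p ∷ [] , [] , d ⟩
    in-store : ∀ {d} → Pending ⟨ [] , p ∷ [] , d ⟩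

  Pending-step : ∀ {W s s′} → Pending s → Step CT rules W s s′ → Pending s′
  Pending-step in-goal  (solve q _)   with () ← ↭-singleton-inv (↭-sym q)
  Pending-step in-goal  (introduce q) with refl ← ↭-singleton-inv (↭-sym q) = in-store
  Pending-step in-store (solve q _)   = contradiction (↭-sym q) ¬x∷xs↭[]
  Pending-step in-store (introduce q) = contradiction (↭-sym q) ¬x∷xs↭[]
  Pending-step s (simplify (here refl) () _ _ _ _)
  Pending-step s (propagate (there (here refl)) () _ _ _ _)
  Pending-step in-goal  (propagate (here refl) _ _ _ _ _) = in-goal
  Pending-step in-store (propagate (here refl) _ _ _ _ _) = in-store
  Pending-step in-goal  (simplify (there (here refl)) _ v q (_∷_ _ _ _) _) =
    contradiction (↭-sym q) ¬x∷xs↭[]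
  Pending-step in-store (simplify (there (here refl)) _ v q (_∷_ _ _ (_∷_ _ _ [])) _)
    with () ← ↭-length q

  Pending-star : ∀ {W s W′ s′} → Pending s → Star (Transition CT rules) (W , s) (W′ , s′) →
                 Pending s′
  Pending-star s ε                  = s
  Pending-star s ((step , _) ◅ ts) = Pending-star (Pending-step s step) ts

  -- With an empty goal the invariant leaves `p` in the store, where `loop` can always fire again.
  p-diverges : ∀ {K d} → ¬ _⊢_⇓_,_ CT rules (user p ∷ []) K d
  p-diverges (W , ts , final) with in-store ← Pending-star in-goal ts =
    final _ (propagate (here refl) refl (loop-fresh W) ↭-refl (_∷_ _ _ []) (λ M m σ _ →
      ∃ᶠ⁺ M (concatMap fvᵘ (map (renᵘ id) (p ∷ []))) (⋀ (args≐args ++ []) ∧ true) (λ _ → refl)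
        (⋀-++⁺ M args≐args (args≐args-valid M m σ) tt , tt)) , refl)

  pp-cancels : _⊢_⇓_,_ CT rules (user p ∷ user p ∷ []) [] cancelled
  pp-cancels = _ ,
    (introduce ↭-refl , refl) ◅ (introduce ↭-refl , refl) ◅
    (simplify (there (here refl)) refl (cancel-fresh _) ↭-refl (_∷_ _ _ (_∷_ _ _ [])) (λ M m σ _ →
      ∃ᶠ⁺ M (concatMap fvᵘ (map (renᵘ id) (p ∷ p ∷ []))) (⋀ pairing ∧ true) (λ _ → refl)
        (proj₁ (⋀-++⁻ M pairing (cancelled-valid M m σ)) , tt)) , refl) ◅ ε ,
    empty-final CT

-- Refuting both kinds of encoding.

corollary4p4 : ∀ {ℓ} (S : Signature) (CT : Theory S) →
    AllowsEquality CT →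
    (∃[ a ] fun-arity S a ≡ 0) →
    (∃[ f ] fun-arity S f > 0) →
    (Πₛ Πₜ : Language S) → ∃ Πₛ →
    (n : ℕ) → n ≥ 2 →
    (𝒢 : Pred (Goal S Πₛ) ℓ) → ContainsSubheads n 𝒢 →
    ¬ AcceptableEncoding CT Πₛ Πₜ n 1 𝒢 ×
    ¬ AcceptableEncodingQA CT Πₛ Πₜ n 1 𝒢
corollary4p4 S CT equality (c , nullary) _ Πₛ Πₜ (q , q∈Πₛ) n n≥2 𝒢 subheads = no-SA , no-QA
  where
  open Source CT equality {Πₛ} q q∈Πₛ c nullary

  P : Program S Πₛ n
  P = program n≥2

  𝒢-p : 𝒢 (user p ∷ [])
  𝒢-p = subheads cancel n≥2 (p ∷ []) (p ∷ []) ↭-refl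

  𝒢-pp : 𝒢 (user p ∷ user p ∷ [])
  𝒢-pp = subheads cancel n≥2 (p ∷ p ∷ []) [] ↭-refl

  module _ (enc : AcceptableEncoding CT Πₛ Πₜ n 1 𝒢) where
    open AcceptableEncoding enc

    no-SA : ⊥
    no-SA
      with _ , (d , ⇓d , refl) , valid ←
        proj₁ (SA-preserved P _ 𝒢-pp) _ (_ , pp-cancels , refl)
      with K₁ , K₂ , d₁ , K↭ , ⇓K₁ ←
        project CT (proj₂ ⟦ P ⟧) _ _ (⟦⟧ᵍ-++ (user p ∷ []) (user p ∷ []))
          (λ M m σ → ∃₋⁻ M (fvᵍ ⟦ user p ∷ user p ∷ [] ⟧ᵍ) (⋀ d) (proj₁ (valid M m σ)
            (∃₋⁺ M (fvᵍ (user p ∷ user p ∷ [])) (⋀ cancelled) (cancelled-valid M m σ))))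
          ⇓d
      -- The projected derivation thus ends with an empty store, giving a data sufficient answer of
      -- the encoded `p`, which pulls back to one of `p`.
      with refl ← ++-conicalˡ K₁ K₂ (↭-empty-inv (↭-sym K↭))
      with _ , (_ , ⇓p , _) , _ ← proj₂ (SA-preserved P _ 𝒢-p) _ (d₁ , ⇓K₁ , refl) =
      p-diverges ⇓p

  module _ (enc : AcceptableEncodingQA CT Πₛ Πₜ n 1 𝒢) where
    open AcceptableEncodingQA enc

    no-QA : ⊥
    no-QA
      with _ , (K , d , ⇓d , refl) , equiv ←
        proj₁ (QA-preserved P _ 𝒢-pp) _ (_ , _ , pp-cancels , refl)
      with K₁ , _ , d₁ , _ , ⇓K₁ ←
        project CT (proj₂ ⟦ P ⟧) _ _ (⟦⟧ᵍ-++ (user p ∷ []) (user p ∷ []))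
          -- The source answer has an empty store and a valid built-in part, so it denotes the empty
          -- multiset under every `σ`; equivalence then yields a valuation satisfying `d`.
          (λ M m σ → let τ , τ≈ , s , _ = proj₁ (equiv M m σ [])
                           (σ , (λ _ → refl) , cancelled-valid M m σ , Homogeneous.refl [])
                     in τ , τ≈ , s)
          ⇓d
      with _ , (_ , _ , ⇓p , _) , _ ← proj₂ (QA-preserved P _ 𝒢-p) _ (K₁ , d₁ , ⇓K₁ , refl) =
      p-diverges ⇓p
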